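{- For every $w \in \tilde{S}_n$, the formal power series $\tilde{F}_w(X)$ is a symmetric function, and it lies in $\Lambda^{(n)}$.
   Context: Fix an integer $n \geq 3$; indices are taken modulo $n$. The affine symmetric group $\tilde{S}_n$ is the Coxeter group with generators $s_0,\dots,s_{n-1}$ and relations $s_i^2=1$, $s_is_{i+1}s_i=s_{i+1}s_is_{i+1}$, $s_is_j=s_js_i$ for $|i-j|\geq 2$ (mod $n$); $l(w)$ is the Coxeter length. The affine nilCoxeter algebra $\mathcal{U}_n$ is the $\mathbb{C}$-algebra generated by $u_0,\dots,u_{n-1}$ with relations $u_i^2=0$, $u_iu_{i+1}u_i=u_{i+1}u_iu_{i+1}$, $u_iu_j=u_ju_i$ for $|i-j|\ge 2$ (mod $n$); it has basis $\{u_w : w\in\tilde S_n\}$ where $u_w=u_{\rho_1}\cdots u_{\rho_l}$ for any reduced word $s_{\rho_1}\cdots s_{\rho_l}$ of $w$. For a subset $A\subsetneq\{0,\dots,n-1\}$, let $u_A$ be the product of the $u_a$, $a\in A$, taken in any order such that whenever $i,i+1$ (mod $n$) both lie in $A$, $u_{i+1}$ occurs before $u_i$ (this is well defined). For $0\le k\le n-1$ put $h_k(\mathbf u)=\sum_{A\subseteq\{0,\dots,n-1\},\,|A|=k}u_A$ (so $h_0(\mathbf u)=1$). Let $\mathcal U_n$ act on $\mathbb{C}[\tilde S_n]$ by $u_i\cdot w=s_iw$ if $l(s_iw)>l(w)$ and $u_i\cdot w=0$ otherwise, and let $\langle w,v\rangle=\delta_{wv}$. The affine Stanley symmetric function $\tilde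 F_w(X)$ is the formal power series in $x_1,x_2,\dots$ whose coefficient of $x_1^{a_1}\cdots x_t^{a_t}$, for any finite sequence $(a_1,\dots,a_t)$ of integers in $[0,n-1]$, is $\langle h_{a_t}(\mathbf u)\cdots h_{a_1}(\mathbf u)\cdot 1,\,w\rangle$ (here $1$ denotes the identity of $\tilde S_n$); the monomials with some exponent $\geq n$ have coefficient $0$. $\Lambda^{(n)}$ denotes the $\mathbb C$-span of the monomial symmetric functions $m_\lambda$ with $\lambda_1\le n-1$. -}

module Defs where

open import Data.Bool using (Bool; true; false; if_then_else_; not; _∧_)
open import Data.Nat using (ℕ; zero; suc; _+_; _*_; _∸_; _≤_; _<_; _≡ᵇ_; _<ᵇ_; _≤ᵇ_)
open import Data.Nat.Properties using (≤-decTotalOrder)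
import Data.Nat.DivMod as NDM
open import Data.Integer as ℤ using (ℤ; +_)
open import Data.Integer.DivMod using (_%ℕ_)
open import Data.List using (List; []; _∷_; map; concatMap; foldl; foldr; upTo; filter; length; reverse)
open import Data.Bool.ListAction using (any)
open import Data.Nat.ListAction using (sum)
open import Data.List.Relation.Unary.All using (All)
open import Data.List.Relation.Unary.Any using (Any)
open import Data.List.Relation.Unary.Linked using (Linked)
open import Data.List.Relation.Binary.Permutation.Propositional using (_↭_)
open import Data.List.Properties using (≡-dec)
open import Data.Vec as Vec using (Vec; tabulate)
import Data.Vec.Properties as VecP
open import Data.Fin using (toℕ)
open import Data.Maybe using (Maybe; just; nothing)
open import Data.Product using (_×_; _,_; proj₁; proj₂; ∃)
open import Relation.Nullary using (¬_; does)
open import Relation.Binary.PropositionalEquality using (_≡_)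
import Data.List.Sort.InsertionSort.Base as ISort

-- Concrete model of the affine symmetric group S̃_n (Lusztig's model):
-- bijections w : ℤ → ℤ with w(x+n) = w(x)+n, represented by the window
-- [w(1), …, w(n)] ∈ Vec ℤ n.  The generator s_i (i ∈ {0,…,n-1}) is the
-- affine permutation exchanging the residue classes i and i+1 (mod n):
-- x ↦ x+1 if x ≡ i, x ↦ x-1 if x ≡ i+1, x ↦ x otherwise.
-- Generators are indexed by natural numbers i < n (indices taken mod n).

-- x mod n for naturals (guarded so that n = 0 needs no NonZero instance)
modℕ : ℕ → ℕ → ℕ
modℕ zero    x = x
modℕ (suc k) x = x NDM.% suc k

resℤ : ℕ → ℤ → ℕ
resℤ zero    x = 0
resℤ (suc k) x = x %ℕ suc k

sGen : (n i : ℕ) → ℤ → ℤ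
sGen n i x =
  if resℤ n x ≡ᵇ modℕ n i then x ℤ.+ ℤ.1ℤ
  else if resℤ n x ≡ᵇ modℕ n (suc i) then x ℤ.- ℤ.1ℤ
  else x

Window : ℕ → Set
Window n = Vec ℤ n

idW : (n : ℕ) → Window n
idW n = tabulate (λ j → + suc (toℕ j))

leftMul : (n i : ℕ) → Window n → Window n
leftMul n i w = Vec.map (sGen n i) w

evalWord : (n : ℕ) → List ℕ → Window n
evalWord n ws = foldr (leftMul n) (idW n) ws

InGroup : (n : ℕ) → Window n → Set
InGroup n w = ∃ λ ws → All (_< n) ws × evalWord n ws ≡ w

wordsOfLength : ℕ → ℕ → List (List ℕ)
wordsOfLength n zero    = [] ∷ []
wordsOfLength n (suc k) = concatMap (λ i → map (i ∷_) (wordsOfLength n k)) (upTo n)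

wordsUpTo : ℕ → ℕ → List (List ℕ)
wordsUpTo n k = concatMap (wordsOfLength n) (upTo (suc k))

_==W_ : {n : ℕ} → Window n → Window n → Bool
w ==W v = does (VecP.≡-dec ℤ._≟_ w v)

lengthAtMost : (n : ℕ) → Window n → ℕ → Bool
lengthAtMost n w k = any (λ ws → evalWord n ws ==W w) (wordsUpTo n k)

-- The module ℂ[S̃_n] (only ℕ-linear combinations of basis vectors occur):
-- a vector is a list of basis elements (a multiset; coefficient of w =
-- number of occurrences).  Each basis element w carries a tag k, which by
-- construction always equals the Coxeter length l(w) (all vectors arise
-- from 1 = identity, of length 0, by length-increasing steps).

Term : ℕ → Set
Term n = Window n × ℕ

Vect : ℕ → Set
Vect n = List (Term n)

uTerm : (n i : ℕ) → Term n → Vect n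
uTerm n i (w , k) =
  if lengthAtMost n (leftMul n i w) k then []
  else (leftMul n i w , suc k) ∷ []

uAct : (n i : ℕ) → Vect n → Vect n
uAct n i v = concatMap (uTerm n i) v

choose : ℕ → List ℕ → List (List ℕ)
choose zero    xs       = [] ∷ []
choose (suc k) []       = []
choose (suc k) (x ∷ xs) = map (x ∷_) (choose k xs) ++' choose (suc k) xs
  where
  _++'_ : List (List ℕ) → List (List ℕ) → List (List ℕ)
  _++'_ = Data.List._++_

memb : ℕ → List ℕ → Bool
memb m A = any (λ a → a ≡ᵇ m) A

firstOut : ℕ → List ℕ → Maybe ℕ
firstOut n A = go (upTo n)
  where
  go : List ℕ → Maybe ℕ
  go []       = nothing
  go (j ∷ js) = if memb j A then go js else just j

-- the elements of A in the order j+1, j+2, …, j+n-1 (mod n), where j ∉ A;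
-- they are applied to a vector in this order, i.e. u_A is the product
-- u_{m_r} ⋯ u_{m_1}; whenever i, i+1 ∈ A, u_{i+1} occurs before (to the
-- left of) u_i, as required.
applyOrder : ℕ → List ℕ → List ℕ
applyOrder n A with firstOut n A
... | nothing = []
... | just j  = filter (λ m → memb m A ≟b true)
                  (map (λ t → modℕ n (j + suc t)) (upTo (n ∸ 1)))
  where
  open import Relation.Nullary.Decidable using (Dec)
  _≟b_ = Data.Bool._≟_

-- u_A · v   (A a proper subset of {0,…,n-1})
uSubset : (n : ℕ) → List ℕ → Vect n → Vect n
uSubset n A v = foldl (λ v' m → uAct n m v') v (applyOrder n A)

hAct : (n k : ℕ) → Vect n → Vect n
hAct n k v = concatMap (λ A → uSubset n A v) (choose k (upTo n))

pairing : {n : ℕ} → Vect n → Window n → ℕ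
pairing v w = length (filter (λ t → proj₁ t ≟W w) v)
  where
  _≟W_ = VecP.≡-dec ℤ._≟_

-- coefficient of x₁^{a₁} ⋯ x_t^{a_t} in F̃_w :
--   ⟨ h_{a_t}(u) ⋯ h_{a_1}(u) · 1 , w ⟩, and 0 if some aᵢ ≥ n
affStanleyCoeff : (n : ℕ) → Window n → List ℕ → ℕ
affStanleyCoeff n w a =
  if any (λ ai → n ≤ᵇ ai) a then 0
  else pairing (foldl (λ v k → hAct n k v) ((idW n , 0) ∷ []) a) w

-- Formal power series in x₁, x₂, … with ℕ coefficients, given by the
-- coefficient of each monomial x₁^{a₁} ⋯ x_t^{a_t}, a = [a₁,…,a_t].

Series : Set
Series = List ℕ → ℕ

IsSymmetric : Series → Set
IsSymmetric f = ∀ a b → a ↭ b → f a ≡ f b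

BoundedDegree : Series → Set
BoundedDegree f = ∃ λ d → ∀ a → ¬ (f a ≡ 0) → sum a ≤ d

IsSymmetricFunction : Series → Set
IsSymmetricFunction f = IsSymmetric f × BoundedDegree f

_≥_ : ℕ → ℕ → Set
m ≥ k = k ≤ m

IsPartition : List ℕ → Set
IsPartition λs = All (0 <_) λs × Linked _≥_ λs

module S = ISort ≤-decTotalOrder

shape : List ℕ → List ℕ
shape a = reverse (S.sort (filter (λ x → 0 Data.Nat.<? x) a))

monomialSym : List ℕ → Series
monomialSym λs a = if does (≡-dec Data.Nat._≟_ (shape a) λs) then 1 else 0

InLambdaN : ℕ → Series → Set
InLambdaN n f =
  ∃ λ (L : List (List ℕ × ℕ)) →
    All (λ p → IsPartition (proj₁ p) × All (_≤ n ∸ 1) (proj₁ p)) L ×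
    (∀ a → f a ≡ sum (map (λ p → proj₂ p * monomialSym (proj₁ p) a) L))

{-# OPTIONS --safe #-}
module Submission where

-- Read w through the n-periodic sequence p = w⁻¹ : ℤ → ℤ.  Then u_i swaps p(i) and p(i+1) if
-- p(i) < p(i+1) and kills w otherwise (exchange condition), and a cyclically decreasing u_A is a
-- carrier moving once around the circle: holding c and meeting x = p(i+1) it either drops c and
-- picks up x (i ∉ A), or, if c < x, lets x pass (i ∈ A).  So h_k is a row-to-row transfer matrix
-- on a cylinder, a trace over the value held.  For two carriers c, d the operator
-- 1 + (x − y) E, with E g (c , d) = [d < c] g (d , c), intertwines the two orders of the spectral
-- parameters x, y column by column; taking traces gives h_k h_l = h_l h_k, hence symmetry.
-- The degree bound holds because each h_k adds k to the length.

-- The intertwiner is never inverted. Let T and T′ be the two-carrier matrices with the two orders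
-- of x and y, and R = 1 + (x - y) E; what is known is R T = T′ R. On the diagonal, the E terms
-- contain only entries leading from a pair of hands to the reversed pair, and for just these
-- entries both E terms of the intertwining relation drop out, so that T and T′ agree there. The
-- corrections therefore cancel and the traces coincide. The parameters x and y do not occur as
-- variables: a monomial is a pair of counters handed to a continuation, and fixing K and L extracts
-- one coefficient. A carrier turns the values of p read from o + 1 into the values of the new
-- sequence read from o. A product of two h's thus starts at the window at 2 and ends at the one at
-- 0. A hand may be any integer, but closing up confines it to a finite list, which has to be common
-- to both carriers. The commutation so obtained concerns multiplicities of single group elements;
-- it becomes an equality of multisets before it is used inside longer products.

open import Defs
open import Data.Bool using (Bool; true; false; if_then_else_; T)
import Data.Bool as Bool
open import Data.Bool.ListAction using (any)
open import Data.Nat as ℕ using (ℕ; zero; suc)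
open import Data.Nat.ListAction using (sum)
import Data.Nat.Properties as ℕP
open import Data.Integer as ℤ using (ℤ; +_; -[1+_]; 0ℤ; 1ℤ; -1ℤ; _+_; _*_; _-_; -_; _<_; _≤_; _<?_; _≟_)
import Data.Integer.Properties as ℤP
open import Data.Integer.DivMod using (_/ℕ_; n%ℕd<d; a≡a%ℕn+[a/ℕn]*n)
open import Data.Integer.Tactic.RingSolver using (solve-∀)
open import Algebra.Properties.AbelianGroup ℤP.+-0-abelianGroup using (∙-cancelˡ; ∙-cancelʳ)
open import Data.Fin using (toℕ; fromℕ<)
import Data.Fin.Properties as FinP
open import Data.List using (List; []; _∷_; map; concatMap; foldl; foldr; upTo; applyUpTo; deduplicate; reverse; filter; length; _++_; _∷ʳ_)
import Data.List.Properties as ListP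
open import Data.List.Membership.Propositional using (_∈_; find)
import Data.List.Membership.Propositional.Properties as ∈P
open import Data.List.Relation.Binary.Permutation.Propositional as Perm using (_↭_; prep; swap; ↭-sym; ↭-trans)
import Data.List.Relation.Binary.Permutation.Propositional.Properties as PermP
open import Data.List.Relation.Unary.All as All using (All; []; _∷_)
import Data.List.Relation.Unary.All.Properties as AllP
open import Data.List.Relation.Unary.AllPairs using ([]; _∷_)
open import Data.List.Relation.Unary.Any as Any using (here; there)
open import Data.List.Relation.Unary.Linked as Linked using (Linked; []; [-]; _∷_)
open import Data.List.Relation.Unary.Unique.Propositional using (Unique)
import Data.List.Relation.Unary.Unique.DecPropositional.Properties as UniqueP
import Data.List.Sort.InsertionSort.Properties ℕP.≤-decTotalOrder as SortP
open import Data.Maybe using (Maybe; just; nothing)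
open import Data.Product using (_×_; _,_; proj₁; proj₂; ∃)
open import Data.Sum using (_⊎_; inj₁; inj₂)
open import Data.Empty using (⊥-elim)
open import Data.Vec as Vec using (tabulate; lookup)
import Data.Vec.Properties as VecP
open import Function using (_∘_; id)
open import Function.Bundles using (mk⇔)
open import Relation.Nullary using (¬_; does; yes; no; Dec)
open import Relation.Nullary.Decidable using (_×-dec_; does-⇔)
open import Relation.Binary.Definitions using (tri<; tri≈; tri>)
open import Relation.Binary.PropositionalEquality

private variable
  A B : Set

-- Finite sums

infix 3 Σl
Σl : List A → (A → ℤ) → ℤ
Σl []       f = 0ℤ
Σl (x ∷ xs) f = f x + Σl xs f

syntax Σl xs (λ x → e) = Σ[ x ← xs ] e

[_]·_ : Bool → ℤ → ℤ
[ b ]· z = if b then z else 0ℤ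

infixr 8 [_]·_

Σl-cong : {f g : A → ℤ} (xs : List A) → (∀ x → x ∈ xs → f x ≡ g x) → Σl xs f ≡ Σl xs g
Σl-cong []       e = refl
Σl-cong (x ∷ xs) e = cong₂ _+_ (e x (here refl)) (Σl-cong xs (λ y y∈ → e y (there y∈)))

Σl-0 : (xs : List A) → Σl xs (λ _ → 0ℤ) ≡ 0ℤ
Σl-0 []       = refl
Σl-0 (x ∷ xs) = trans (ℤP.+-identityˡ _) (Σl-0 xs)

Σl-+ : (xs : List A) (f g : A → ℤ) → Σl xs (λ x → f x + g x) ≡ Σl xs f + Σl xs g
Σl-+ []       f g = refl
Σl-+ (x ∷ xs) f g = trans (cong (_+_ (f x + g x)) (Σl-+ xs f g)) (mid (f x) (g x) (Σl xs f) (Σl xs g))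
  where
  mid : ∀ a b c d → (a + b) + (c + d) ≡ (a + c) + (b + d)
  mid = solve-∀

Σl-++ : (xs ys : List A) (f : A → ℤ) → Σl (xs ++ ys) f ≡ Σl xs f + Σl ys f
Σl-++ []       ys f = sym (ℤP.+-identityˡ _)
Σl-++ (x ∷ xs) ys f = trans (cong (_+_ (f x)) (Σl-++ xs ys f)) (sym (ℤP.+-assoc (f x) _ _))

Σl-map : (h : A → B) (xs : List A) (f : B → ℤ) → Σl (map h xs) f ≡ Σl xs (f ∘ h)
Σl-map h []       f = refl
Σl-map h (x ∷ xs) f = cong (_+_ (f (h x))) (Σl-map h xs f)

Σl-concatMap : (h : A → List B) (xs : List A) (f : B → ℤ) →
  Σl (concatMap h xs) f ≡ Σl xs (λ x → Σl (h x) f)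
Σl-concatMap h []       f = refl
Σl-concatMap h (x ∷ xs) f =
  trans (Σl-++ (h x) (concatMap h xs) f) (cong (_+_ (Σl (h x) f)) (Σl-concatMap h xs f))

Σl-swap : (xs : List A) (ys : List B) (f : A → B → ℤ) →
  Σl xs (λ x → Σl ys (f x)) ≡ Σl ys (λ y → Σl xs (λ x → f x y))
Σl-swap []       ys f = sym (Σl-0 ys)
Σl-swap (x ∷ xs) ys f = trans (cong (_+_ (Σl ys (f x))) (Σl-swap xs ys f)) (sym (Σl-+ ys (f x) _))

Σl-[]· : (b : Bool) (xs : List A) (f : A → ℤ) → Σl xs (λ x → [ b ]· f x) ≡ [ b ]· Σl xs f
Σl-[]· true  xs f = refl
Σl-[]· false xs f = Σl-0 xs

Σl-single : (xs : List A) (f : A → ℤ) {x : A} → Unique xs → x ∈ xs →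
  (∀ y → y ≢ x → f y ≡ 0ℤ) → Σl xs f ≡ f x
Σl-single (x ∷ xs) f (x∉ ∷ u) (here refl) e =
  trans (cong (_+_ (f x)) (trans (Σl-cong xs (λ y y∈ → e y (≢-sym (All.lookup x∉ y∈)))) (Σl-0 xs)))
        (ℤP.+-identityʳ _)
Σl-single (z ∷ xs) f (z∉ ∷ u) (there x∈) e =
  trans (cong₂ _+_ (e z (All.lookup z∉ x∈)) (Σl-single xs f u x∈ e)) (ℤP.+-identityˡ _)

[]·-+ : ∀ b u v → [ b ]· (u + v) ≡ [ b ]· u + [ b ]· v
[]·-+ true  u v = refl
[]·-+ false u v = refl

-- Carriers, and two carriers at one column

infix 4 _<ᵇ_
_<ᵇ_ : ℤ → ℤ → Bool
c <ᵇ d = does (c <? d)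

-- A carrier holding c meets x: it either drops c and takes x, or, if c < x, it keeps c and lets x
-- through.  The last argument of the continuation counts the latter.

row : List ℤ → (List ℤ → ℤ → ℕ → ℤ) → ℤ → ℕ → ℤ
row []       G c k = G [] c k
row (x ∷ xs) G c k =
  row xs (λ ys → G (c ∷ ys)) x k + [ c <ᵇ x ]· row xs (λ ys → G (x ∷ ys)) c (suc k)

-- The arguments are the two hands and the exponents of the two spectral parameters; raising the
-- first or second counter is multiplication by x or y.
Cont : Set
Cont = ℤ → ℤ → ℕ → ℕ → ℤ

swapCount : Cont → Cont
swapCount g c d k l = g c d l k

-- Two stacked rows: the second carrier `d` meets what the first one leaves behind, which is `c`
-- after a drop and `x` after a pass.
col : ℤ → (ℤ → Cont) → Cont
col x g c d k l =
  (g d x c k l + [ d <ᵇ c ]· g c x d k (suc l)) +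
  [ c <ᵇ x ]· (g d c x (suc k) l + [ d <ᵇ x ]· g x c d (suc k) (suc l))

col′ : ℤ → (ℤ → Cont) → Cont
col′ x g = swapCount (col x (λ z → swapCount (g z)))

R : Cont → Cont
R g c d k l = g c d k l + [ d <ᵇ c ]· (g d c (suc k) l - g d c k (suc l))

<ᵇ-true : ∀ {c d} → c < d → (c <ᵇ d) ≡ true
<ᵇ-true {c} {d} c<d with c <? d
... | yes _ = refl
... | no ¬p = ⊥-elim (¬p c<d)

<ᵇ-false : ∀ {c d} → ¬ c < d → (c <ᵇ d) ≡ false
<ᵇ-false {c} {d} c≮d with c <? d
... | yes p = ⊥-elim (c≮d p)
... | no _  = refl

<ᵇ-asym : ∀ c d → (c <ᵇ d) ≡ true → (d <ᵇ c) ≡ false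
<ᵇ-asym c d e with c <? d
... | yes p = <ᵇ-false (ℤP.<-asym p)

<ᵇ-trans : ∀ c d x → (d <ᵇ c) ≡ true → (c <ᵇ x) ≡ true → (d <ᵇ x) ≡ true
<ᵇ-trans c d x e e′ with d <? c | c <? x
... | yes p | yes q = <ᵇ-true (ℤP.<-trans p q)

-- The Yang–Baxter equation for one column.
R-col : ∀ x g c d k l → R (col x g) c d k l ≡ col′ x (λ z → R (g z)) c d k l
R-col x g c d k l with d <ᵇ c in dc | c <ᵇ x in cx
... | true | true rewrite <ᵇ-trans c d x dc cx | <ᵇ-asym d c dc | <ᵇ-asym c x cx =
  ring (g d x c k l) (g c x d k (suc l)) (g d c x (suc k) l) (g x c d (suc k) (suc l))
    (g c x d (suc k) l) (g c d x (suc (suc k)) l) (g x d c (suc (suc k)) (suc l))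
    (g d c x k (suc l)) (g c d x (suc k) (suc l)) (g x d c (suc k) (suc (suc l)))
  where
  ring : ∀ a b e f p q r u v w →
    (a + b + (e + f)) + ((p + 0ℤ + (q + r)) - (b + 0ℤ + (v + w))) ≡
    (a + (e - u) + (p + (q - v))) + (u + 0ℤ + (f + (r - w)))
  ring = solve-∀
... | false | true rewrite <ᵇ-asym c x cx =
  ring (g d x c k l) (g d c x (suc k) l) (g d c x k (suc l)) _ _
    (dx (d <ᵇ x))
  where
  ring : ∀ a e u z z′ → z ≡ z′ →
    a + 0ℤ + (e + z) + 0ℤ ≡ a + (e - u) + 0ℤ + (u + 0ℤ + z′)
  ring a e u z _ refl = lem a e u z
    where
    lem : ∀ a e u z → a + 0ℤ + (e + z) + 0ℤ ≡ a + (e - u) + 0ℤ + (u + 0ℤ + z)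
    lem = solve-∀
  dx : ∀ b → [ b ]· g x c d (suc k) (suc l) ≡ [ b ]· (g x c d (suc k) (suc l) + 0ℤ)
  dx b = cong ([ b ]·_) (sym (ℤP.+-identityʳ _))
R-col x g c d k l | true | false rewrite <ᵇ-asym d c dc with d <ᵇ x
...   | true =
  ring (g d x c k l) (g c x d k (suc l)) (g c x d (suc k) l)
    (g c d x (suc (suc k)) l) (g c d x (suc k) (suc l))
  where
  ring : ∀ a b p q v →
    a + b + 0ℤ + ((p + 0ℤ + (q + 0ℤ)) - (b + 0ℤ + (v + 0ℤ))) ≡ a + 0ℤ + (p + (q - v)) + 0ℤ
  ring = solve-∀
...   | false =
  ring (g d x c k l) (g c x d k (suc l)) (g c x d (suc k) l)
  where
  ring : ∀ a b p → a + b + 0ℤ + ((p + 0ℤ + 0ℤ) - (b + 0ℤ + 0ℤ)) ≡ a + 0ℤ + (p + 0ℤ) + 0ℤ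
  ring = solve-∀
R-col x g c d k l | false | false = refl

col-cong : ∀ x {g h : ℤ → Cont} → (∀ z c d k l → g z c d k l ≡ h z c d k l) →
  ∀ c d k l → col x g c d k l ≡ col x h c d k l
col-cong x e c d k l = cong₂ _+_
  (cong₂ _+_ (e d x c k l) (cong ([ d <ᵇ c ]·_) (e c x d k (suc l))))
  (cong ([ c <ᵇ x ]·_) (cong₂ _+_ (e d c x (suc k) l) (cong ([ d <ᵇ x ]·_) (e x c d (suc k) (suc l)))))

-- From one column to whole rows

rows : List ℤ → (List ℤ → Cont) → Cont
rows []       g = g []
rows (x ∷ xs) g = col x (λ z → rows xs (λ zs → g (z ∷ zs)))

rows′ : List ℤ → (List ℤ → Cont) → Cont
rows′ xs g = swapCount (rows xs (λ zs → swapCount (g zs)))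

R-rows : ∀ xs g c d k l → R (rows xs g) c d k l ≡ rows′ xs (λ zs → R (g zs)) c d k l
R-rows []       g c d k l = refl
R-rows (x ∷ xs) g c d k l = trans
  (R-col x (λ z → rows xs (λ zs → g (z ∷ zs))) c d k l)
  -- Between neighbouring columns the two exchanges of counters cancel, so the induction hypothesis
  -- is used with `k` and `l` interchanged.
  (col-cong x (λ z c d k l → R-rows xs (λ zs → g (z ∷ zs)) c d l k) c d l k)

rows-cong : ∀ xs {g h : List ℤ → Cont} → (∀ zs c d k l → g zs c d k l ≡ h zs c d k l) →
  ∀ c d k l → rows xs g c d k l ≡ rows xs h c d k l
rows-cong []       e = e []
rows-cong (x ∷ xs) e = col-cong x (λ z → rows-cong xs (λ zs → e (z ∷ zs)))

-- Prepares for `R` acting on the final hands: its coefficient `β` then depends on the fixed targets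
-- alone and can be pulled out of every column.
col-linear : ∀ x β (g h h′ : ℤ → Cont) c d k l →
  col x (λ z c d k l → g z c d k l + [ β ]· (h z c d k l - h′ z c d k l)) c d k l ≡
  col x g c d k l + [ β ]· (col x h c d k l - col x h′ c d k l)
col-linear x false g h h′ c d k l =
  trans (col-cong x (λ z c d k l → ℤP.+-identityʳ (g z c d k l)) c d k l)
        (sym (ℤP.+-identityʳ _))
col-linear x true g h h′ c d k l with d <ᵇ c | c <ᵇ x | d <ᵇ x
... | true  | true  | true  = lem (g d x c k l) (h d x c k l) (h′ d x c k l)
    (g c x d k (suc l)) (h c x d k (suc l)) (h′ c x d k (suc l))
    (g d c x (suc k) l) (h d c x (suc k) l) (h′ d c x (suc k) l)
    (g x c d (suc k) (suc l)) (h x c d (suc k) (suc l)) (h′ x c d (suc k) (suc l))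
  where
  lem : ∀ a b e p q r u v w x y z →
    (a + (b - e)) + (p + (q - r)) + ((u + (v - w)) + (x + (y - z))) ≡
    a + p + (u + x) + ((b + q + (v + y)) - (e + r + (w + z)))
  lem = solve-∀
... | true  | true  | false = lem (g d x c k l) (h d x c k l) (h′ d x c k l)
    (g c x d k (suc l)) (h c x d k (suc l)) (h′ c x d k (suc l))
    (g d c x (suc k) l) (h d c x (suc k) l) (h′ d c x (suc k) l)
  where
  lem : ∀ a b e p q r u v w →
    (a + (b - e)) + (p + (q - r)) + ((u + (v - w)) + 0ℤ) ≡
    a + p + (u + 0ℤ) + ((b + q + (v + 0ℤ)) - (e + r + (w + 0ℤ)))
  lem = solve-∀
... | false | true  | true  = lem (g d x c k l) (h d x c k l) (h′ d x c k l)
    (g d c x (suc k) l) (h d c x (suc k) l) (h′ d c x (suc k) l)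
    (g x c d (suc k) (suc l)) (h x c d (suc k) (suc l)) (h′ x c d (suc k) (suc l))
  where
  lem : ∀ a b e u v w x y z →
    (a + (b - e)) + 0ℤ + ((u + (v - w)) + (x + (y - z))) ≡
    a + 0ℤ + (u + x) + ((b + 0ℤ + (v + y)) - (e + 0ℤ + (w + z)))
  lem = solve-∀
... | false | true  | false = lem (g d x c k l) (h d x c k l) (h′ d x c k l)
    (g d c x (suc k) l) (h d c x (suc k) l) (h′ d c x (suc k) l)
  where
  lem : ∀ a b e u v w →
    (a + (b - e)) + 0ℤ + ((u + (v - w)) + 0ℤ) ≡
    a + 0ℤ + (u + 0ℤ) + ((b + 0ℤ + (v + 0ℤ)) - (e + 0ℤ + (w + 0ℤ)))
  lem = solve-∀
... | true  | false | _ = lem (g d x c k l) (h d x c k l) (h′ d x c k l)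
    (g c x d k (suc l)) (h c x d k (suc l)) (h′ c x d k (suc l))
  where
  lem : ∀ a b e p q r →
    (a + (b - e)) + (p + (q - r)) + 0ℤ ≡ a + p + 0ℤ + ((b + q + 0ℤ) - (e + r + 0ℤ))
  lem = solve-∀
... | false | false | _ = lem (g d x c k l) (h d x c k l) (h′ d x c k l)
  where
  lem : ∀ a b e → (a + (b - e)) + 0ℤ + 0ℤ ≡ a + 0ℤ + 0ℤ + ((b + 0ℤ + 0ℤ) - (e + 0ℤ + 0ℤ))
  lem = solve-∀

rows-linear : ∀ xs β (g h h′ : List ℤ → Cont) c d k l →
  rows xs (λ zs c d k l → g zs c d k l + [ β ]· (h zs c d k l - h′ zs c d k l)) c d k l ≡
  rows xs g c d k l + [ β ]· (rows xs h c d k l - rows xs h′ c d k l)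
rows-linear []       β g h h′ c d k l = refl
rows-linear (x ∷ xs) β g h h′ c d k l = trans
  (col-cong x (λ z → rows-linear xs β (λ zs → g (z ∷ zs)) (λ zs → h (z ∷ zs)) (λ zs → h′ (z ∷ zs))) c d k l)
  (col-linear x β (λ z → rows xs (λ zs → g (z ∷ zs))) (λ z → rows xs (λ zs → h (z ∷ zs)))
    (λ z → rows xs (λ zs → h′ (z ∷ zs))) c d k l)

-- Counters are only incremented, never tested on the way, so multiplication by a spectral parameter
-- commutes with the transfer.
rows-suc₁ : ∀ xs (g : List ℤ → Cont) c d k l →
  rows xs (λ zs c d k → g zs c d (suc k)) c d k l ≡ rows xs g c d (suc k) l
rows-suc₁ []       g c d k l = refl
rows-suc₁ (x ∷ xs) g = λ c d k l → col-cong x (λ z → rows-suc₁ xs (λ zs → g (z ∷ zs))) c d k l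

rows-suc₂ : ∀ xs (g : List ℤ → Cont) c d k l →
  rows xs (λ zs c d k l → g zs c d k (suc l)) c d k l ≡ rows xs g c d k (suc l)
rows-suc₂ []       g c d k l = refl
rows-suc₂ (x ∷ xs) g = λ c d k l → col-cong x (λ z → rows-suc₂ xs (λ zs → g (z ∷ zs))) c d k l

row-+ : ∀ xs (G H : List ℤ → ℤ → ℕ → ℤ) c k →
  row xs (λ ys c k → G ys c k + H ys c k) c k ≡ row xs G c k + row xs H c k
row-+ []       G H c k = refl
row-+ (x ∷ xs) G H c k = trans
  (cong₂ _+_ (row-+ xs (λ ys → G (c ∷ ys)) (λ ys → H (c ∷ ys)) x k)
    (trans (cong ([ c <ᵇ x ]·_) (row-+ xs (λ ys → G (x ∷ ys)) (λ ys → H (x ∷ ys)) c (suc k)))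
           ([]·-+ (c <ᵇ x) _ _)))
  (lem (row xs (λ ys → G (c ∷ ys)) x k) _ _ _)
  where
  lem : ∀ a b e f → (a + b) + (e + f) ≡ (a + e) + (b + f)
  lem = solve-∀

row-cong : ∀ xs {G H : List ℤ → ℤ → ℕ → ℤ} → (∀ ys c k → G ys c k ≡ H ys c k) →
  ∀ c k → row xs G c k ≡ row xs H c k
row-cong []       e c k = e [] c k
row-cong (x ∷ xs) e c k = cong₂ _+_ (row-cong xs (λ ys → e (c ∷ ys)) x k)
  (cong ([ c <ᵇ x ]·_) (row-cong xs (λ ys → e (x ∷ ys)) c (suc k)))

row-0 : ∀ xs c k → row xs (λ _ _ _ → 0ℤ) c k ≡ 0ℤ
row-0 []       c k = refl
row-0 (x ∷ xs) c k rewrite row-0 xs x k | row-0 xs c (suc k) with c <ᵇ x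
... | true  = refl
... | false = refl

row-[]· : ∀ b xs (G : List ℤ → ℤ → ℕ → ℤ) c k →
  row xs (λ ys c k → [ b ]· G ys c k) c k ≡ [ b ]· row xs G c k
row-[]· true  xs G c k = refl
row-[]· false xs G c k = row-0 xs c k

row-Σ : ∀ (S : List A) xs (G : A → List ℤ → ℤ → ℕ → ℤ) c k →
  row xs (λ ys c k → Σ[ a ← S ] G a ys c k) c k ≡ (Σ[ a ← S ] row xs (G a) c k)
row-Σ []      xs G c k = row-0 xs c k
row-Σ (a ∷ S) xs G c k = trans (row-+ xs (G a) (λ ys c k → Σ[ a ← S ] G a ys c k) c k)
  (cong (_+_ (row xs (G a) c k)) (row-Σ S xs G c k))

-- The second row can be run in step with the first, because each intermediate value is written
-- before the next column is reached. A composite of two transfers thereby becomes one two-carrier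
-- system.
row-row : ∀ xs (g : List ℤ → Cont) c d k l →
  row xs (λ ys c k → row ys (λ zs d l → g zs c d k l) d l) c k ≡ rows xs g c d k l
row-row []       g c d k l = refl
row-row (x ∷ xs) g c d k l = cong₂ _+_
  (trans (row-+ xs _ _ x k)
    (cong₂ _+_ (row-row xs (λ zs → g (d ∷ zs)) x c k l)
      (trans (row-[]· (d <ᵇ c) xs _ x k)
        (cong ([ d <ᵇ c ]·_) (row-row xs (λ zs → g (c ∷ zs)) x d k (suc l))))))
  (cong ([ c <ᵇ x ]·_) (trans (row-+ xs _ _ c (suc k))
    (cong₂ _+_ (row-row xs (λ zs → g (d ∷ zs)) c x (suc k) l)
      (trans (row-[]· (d <ᵇ x) xs _ c (suc k))
        (cong ([ d <ᵇ x ]·_) (row-row xs (λ zs → g (x ∷ zs)) c d (suc k) (suc l)))))))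

<-cancelʳ-+ : ∀ {a b} N → a + N < b + N → a < b
<-cancelʳ-+ {a} {b} N q = subst₂ _<_ (lem a N) (lem b N) (ℤP.+-monoˡ-< (- N) q)
  where
  lem : ∀ a N → a + N + - N ≡ a
  lem = solve-∀

≡ᵇ-true : ∀ {a b} → a ≡ b → (a ℕ.≡ᵇ b) ≡ true
≡ᵇ-true {zero}  refl = refl
≡ᵇ-true {suc a} refl = ≡ᵇ-true {a} refl

≡ᵇ-false : ∀ {a b} → a ≢ b → (a ℕ.≡ᵇ b) ≡ false
≡ᵇ-false {zero}  {zero}  a≢b = ⊥-elim (a≢b refl)
≡ᵇ-false {zero}  {suc b} a≢b = refl
≡ᵇ-false {suc a} {zero}  a≢b = refl
≡ᵇ-false {suc a} {suc b} a≢b = ≡ᵇ-false (a≢b ∘ cong suc)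

infix 4 _==_
_==_ : ℤ → ℤ → Bool
c == d = does (c ≟ d)

[]·-comm : ∀ b e u → [ b ]· [ e ]· u ≡ [ e ]· [ b ]· u
[]·-comm true  e     u = refl
[]·-comm false true  u = refl
[]·-comm false false u = refl

[]·-cancel : ∀ b u → [ b ]· (u - u) ≡ 0ℤ
[]·-cancel true  u = ℤP.+-inverseʳ u
[]·-cancel false u = refl

-- Traces of transfer matrices on the cylinder commute

module Trace (N : ℤ) (S : List ℤ) where

  -- Closing up with the shift N forces at least one drop: a carrier that only passes returns with
  -- c ≠ c + N.  This is how the full set of generators is excluded from h_K.
  transfer : ℕ → (List ℤ → ℤ) → List ℤ → ℤ
  transfer K φ P = Σ[ c ← S ] row P (λ ys c′ k → [ c′ == c + N ]· [ does (k ℕ.≟ K) ]· φ ys) c 0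

  module _ (φ : List ℤ → ℤ) where

    -- Makes `rows` a matrix: with this continuation it gives the entry from the starting hands to
    -- the final hands `a + N`, `b + N`, at the chosen powers of the parameters.
    closed : ℕ → ℕ → ℤ → ℤ → List ℤ → Cont
    closed K L a b zs c d k l =
      [ c == a + N ]· [ d == b + N ]· [ does (k ℕ.≟ K) ]· [ does (l ℕ.≟ L) ]· φ zs

    transfer-transfer : ∀ K L P → transfer K (transfer L φ) P ≡
      (Σ[ a ← S ] Σ[ b ← S ] rows P (closed K L a b) a b 0 0)
    transfer-transfer K L P = Σl-cong S λ a _ → trans
      (trans (row-cong P (λ ys c k → pull (c == a + N) (does (k ℕ.≟ K)) ys) a 0)
             (row-Σ S P _ a 0))
      (Σl-cong S λ b _ → row-row P (closed K L a b) a b 0 0)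
      where
      pull : ∀ β γ ys →
        [ β ]· [ γ ]· transfer L φ ys ≡
        (Σ[ b ← S ] row ys (λ zs d l → [ β ]· [ d == b + N ]· [ γ ]· [ does (l ℕ.≟ L) ]· φ zs) b 0)
      pull true true ys = refl
      pull true false ys = sym (trans
        (Σl-cong S (λ b _ → trans (row-cong ys (λ zs d l → []·-comm (d == b + N) false ([ does (l ℕ.≟ L) ]· φ zs)) b 0)
          (row-0 ys b 0))) (Σl-0 S))
      pull false γ ys = sym (trans (Σl-cong S (λ b _ → row-0 ys b 0)) (Σl-0 S))

    <ᵇ-shift : ∀ a b → (a + N <ᵇ b + N) ≡ (a <ᵇ b)
    <ᵇ-shift a b with a <? b
    ... | yes p = <ᵇ-true (ℤP.+-monoˡ-< N p)
    ... | no ¬p = <ᵇ-false (λ q → ¬p (<-cancelʳ-+ N q))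

    -- `closed` is an indicator of the pair of hands, so the comparison of the hands received
    -- becomes a comparison of the targets; translation by `N` preserves it. This moves `R` to the
    -- other side of the matrix.
    R-closed : ∀ K L a b zs c d k l → R (closed K L a b zs) c d k l ≡
      closed K L a b zs c d k l +
      [ a <ᵇ b ]· (closed K L b a zs c d (suc k) l - closed K L b a zs c d k (suc l))
    R-closed K L a b zs c d k l with c ≟ b + N | d ≟ a + N
    ... | yes refl | yes refl rewrite <ᵇ-shift a b = refl
    ... | yes refl | no _ = cong (_+_ (closed K L a b zs (b + N) d k l)) (trans ([]·-cancel (d <ᵇ b + N) 0ℤ) (sym ([]·-cancel (a <ᵇ b) 0ℤ)))
    ... | no _ | yes refl = cong (_+_ (closed K L a b zs c (a + N) k l)) (trans ([]·-cancel (a + N <ᵇ c) 0ℤ) (sym ([]·-cancel (a <ᵇ b) 0ℤ)))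
    ... | no _ | no _ = cong (_+_ (closed K L a b zs c d k l)) (trans ([]·-cancel (d <ᵇ c) 0ℤ) (sym ([]·-cancel (a <ᵇ b) 0ℤ)))

    module _ (K L : ℕ) (P : List ℤ) where

      entry entry′ : ℤ → ℤ → Cont
      entry  a b = rows P (closed K L a b)
      entry′ a b = rows′ P (closed K L a b)

      -- This is R T = T′ R entry by entry: `R` acts on the starting hands on the left and, through
      -- `R-closed`, on the final hands on the right.
      R-entry : ∀ a b c d k l → R (entry a b) c d k l ≡
        entry′ a b c d k l + [ a <ᵇ b ]· (entry′ b a c d (suc k) l - entry′ b a c d k (suc l))
      R-entry a b c d k l = trans (R-rows P (closed K L a b) c d k l)
        (trans (rows-cong P (λ zs c d k l → R-closed K L a b zs c d l k) c d l k)
        (trans (rows-linear P (a <ᵇ b) _ _ _ c d l k)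
        (cong (λ z → entry′ a b c d k l + [ a <ᵇ b ]· z)
          (cong₂ _-_ (rows-suc₂ P (λ zs → swapCount (closed K L b a zs)) c d l k)
                     (rows-suc₁ P (λ zs → swapCount (closed K L b a zs)) c d l k)))))

      -- With the starting pair reversed, both correction terms of `R-entry` carry the same factor
      -- `a <ᵇ b`, which is false here.
      entry-off : ∀ a b k l → (b <ᵇ a) ≡ true → entry a b b a k l ≡ entry′ a b b a k l
      entry-off a b k l b<a with e ← R-entry a b b a k l rewrite <ᵇ-asym b a b<a =
        trans (sym (ℤP.+-identityʳ _)) (trans e (ℤP.+-identityʳ _))

      offDiagonal : ℤ → ℤ → ℤ
      offDiagonal a b = [ b <ᵇ a ]· (entry a b b a 1 0 - entry a b b a 0 1)

      offDiagonal-entry′ : ∀ a b → offDiagonal a b ≡ [ b <ᵇ a ]· (entry′ a b b a 1 0 - entry′ a b b a 0 1)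
      offDiagonal-entry′ a b with b <ᵇ a in b<a
      ... | false = refl
      ... | true  = cong₂ _-_ (entry-off a b 1 0 b<a) (entry-off a b 0 1 b<a)

      -- Summing `R-entry` over the diagonal leaves a correction on each side. By
      -- `offDiagonal-entry′` the right one is the left one with `a` and `b` renamed, so both
      -- cancel.
      trace-swap : (Σ[ a ← S ] Σ[ b ← S ] entry a b a b 0 0) ≡ (Σ[ a ← S ] Σ[ b ← S ] entry′ a b a b 0 0)
      trace-swap = ∙-cancelʳ (Σ[ a ← S ] Σ[ b ← S ] offDiagonal a b) _ _
        (trans (sym (ΣΣ-+ _ _))
        (trans (Σl-cong S (λ a _ → Σl-cong S (λ b _ →
                 trans (R-entry a b a b 0 0) (cong (_+_ (entry′ a b a b 0 0)) (sym (offDiagonal-entry′ b a))))))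
        (trans (ΣΣ-+ _ _)
        (cong (_+_ (Σ[ a ← S ] Σ[ b ← S ] entry′ a b a b 0 0)) (Σl-swap S S (λ a b → offDiagonal b a))))))
        where
        ΣΣ-+ : ∀ (f g : ℤ → ℤ → ℤ) → (Σ[ a ← S ] Σ[ b ← S ] (f a b + g a b)) ≡
          (Σ[ a ← S ] Σ[ b ← S ] f a b) + (Σ[ a ← S ] Σ[ b ← S ] g a b)
        ΣΣ-+ f g = trans (Σl-cong S (λ a _ → Σl-+ S (f a) (g a))) (Σl-+ S _ _)

    -- Exchanging the counters amounts to exchanging the requested exponents, so the primed trace
    -- for `K`, `L` is the unprimed trace for `L`, `K`.
    transfer-comm : ∀ K L P → transfer K (transfer L φ) P ≡ transfer L (transfer K φ) P
    transfer-comm K L P = trans (transfer-transfer K L P) (trans (trace-swap K L P)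
      (trans (Σl-cong S (λ a _ → Σl-cong S (λ b _ → rows-cong P (λ zs c d k l → flip a b zs c d k l) a b 0 0)))
        (sym (transfer-transfer L K P))))
      where
      flip : ∀ a b zs c d k l → closed K L a b zs c d l k ≡ closed L K a b zs c d k l
      flip a b zs c d k l = cong (λ z → [ c == a + N ]· [ d == b + N ]· z)
        ([]·-comm (does (l ℕ.≟ K)) (does (k ℕ.≟ L)) (φ zs))

-- Affine permutations and the exchange condition

<⇒∃+ : ∀ {x y} → x < y → ∃ λ d → y ≡ x + + suc d
<⇒∃+ {x} {y} x<y with y - x in e | ℤP.i≤j⇒0≤j-i (ℤP.<⇒≤ x<y)
... | + suc d | _ = d , trans (lem x y) (cong (_+_ x) e)
  where
  lem : ∀ x y → y ≡ x + (y - x)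
  lem = solve-∀
... | + zero | _ = ⊥-elim (ℤP.<-irrefl (sym (ℤP.i-j≡0⇒i≡j y x e)) x<y)
... | -[1+ _ ] | ()

win : {A : Set} → (ℤ → A) → ℤ → ℕ → List A
win f o zero    = []
win f o (suc r) = f o ∷ win f (o + 1ℤ) r

shift-1 : ∀ o i → o + 1ℤ + + i ≡ o + + suc i
shift-1 o i = ℤP.+-assoc o 1ℤ (+ i)

win-≡ : ∀ {A : Set} (f g : ℤ → A) o r → win f o r ≡ win g o r → ∀ i → i ℕ.< r → f (o + + i) ≡ g (o + + i)
win-≡ f g o (suc r) e zero i<r rewrite ℤP.+-identityʳ o = ListP.∷-injectiveˡ e
win-≡ f g o (suc r) e (suc i) (ℕ.s≤s i<r) =
  subst (λ z → f z ≡ g z) (shift-1 o i) (win-≡ f g (o + 1ℤ) r (ListP.∷-injectiveʳ e) i i<r)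

win-cong : ∀ {A : Set} {f g : ℤ → A} o r → (∀ i → i ℕ.< r → f (o + + i) ≡ g (o + + i)) → win f o r ≡ win g o r
win-cong o zero    e = refl
win-cong {f = f} {g} o (suc r) e = cong₂ _∷_
  (subst (λ z → f z ≡ g z) (ℤP.+-identityʳ o) (e 0 (ℕ.s≤s ℕ.z≤n)))
  (win-cong (o + 1ℤ) r (λ i i<r → subst (λ z → f z ≡ g z) (sym (shift-1 o i)) (e (suc i) (ℕ.s≤s i<r))))

win-∷ʳ : ∀ {A : Set} (f : ℤ → A) o r → win f o (suc r) ≡ win f o r ∷ʳ f (o + + r)
win-∷ʳ f o zero    = cong (λ z → f z ∷ []) (sym (ℤP.+-identityʳ o))
win-∷ʳ f o (suc r) = cong (f o ∷_)
  (trans (win-∷ʳ f (o + 1ℤ) r) (cong (λ z → win f (o + 1ℤ) r ∷ʳ f z) (shift-1 o r)))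

module Affine (n-2 : ℕ) where

  n : ℕ
  n = suc (suc n-2)

  N : ℤ
  N = + n

  res : ℤ → ℕ
  res = resℤ n

  infix 4 _~_
  record _~_ (x y : ℤ) : Set where
    constructor _,_
    field
      quot : ℤ
      eq   : x ≡ y + quot * N

  residue-unique : ∀ a b q → a ℕ.< n → b ℕ.< n → + a ≡ + b + q * N → a ≡ b
  residue-unique a b (+ zero) a< b< e = ℤP.+-injective (trans e (ℤP.+-identityʳ (+ b)))
  residue-unique a b (+ suc j) a< b< e = ⊥-elim (ℕP.<⇒≱ a< (subst (n ℕ.≤_) (sym e′)
    (ℕP.≤-trans (ℕP.m≤m+n n (j ℕ.* n)) (ℕP.m≤n+m (suc j ℕ.* n) b))))
    where
    e′ : a ≡ b ℕ.+ suc j ℕ.* n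
    e′ = ℤP.+-injective (trans e (cong (_+_ (+ b)) (sym (ℤP.pos-* (suc j) n))))
  residue-unique a b -[1+ j ] a< b< e = ⊥-elim (ℕP.<⇒≱ b< (subst (n ℕ.≤_) (sym e′)
    (ℕP.≤-trans (ℕP.m≤m+n n (j ℕ.* n)) (ℕP.m≤n+m (suc j ℕ.* n) a))))
    where
    lem : ∀ a b k → a ≡ b + (- k) → b ≡ a + k
    lem a b k refl = lem′ b k
      where
      lem′ : ∀ b k → b ≡ b + (- k) + k
      lem′ = solve-∀
    e′ : b ≡ a ℕ.+ suc j ℕ.* n
    e′ = ℤP.+-injective (trans
      (lem (+ a) (+ b) (+ suc j * N) (trans e (cong (_+_ (+ b)) (sym (ℤP.neg-distribˡ-* (+ suc j) N)))))
      (cong (_+_ (+ a)) (sym (ℤP.pos-* (suc j) n))))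

  ~-refl : ∀ {x} → x ~ x
  ~-refl {x} = 0ℤ , sym (ℤP.+-identityʳ x)

  ~-reflexive : ∀ {x y} → x ≡ y → x ~ y
  ~-reflexive refl = ~-refl

  ~-sym : ∀ {x y} → x ~ y → y ~ x
  ~-sym {x} {y} (q , refl) = - q , lem y q N
    where
    lem : ∀ y q N → y ≡ y + q * N + - q * N
    lem = solve-∀

  ~-trans : ∀ {x y z} → x ~ y → y ~ z → x ~ z
  ~-trans {z = z} (q , refl) (r , refl) = r + q , lem z q r N
    where
    lem : ∀ z q r N → z + r * N + q * N ≡ z + (r + q) * N
    lem = solve-∀

  ~-+ : ∀ {x y} z → x ~ y → x + z ~ y + z
  ~-+ {y = y} z (q , refl) = q , lem y z q N
    where
    lem : ∀ y z q N → y + q * N + z ≡ y + z + q * N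
    lem = solve-∀

  ~-per : ∀ x q → x + q * N ~ x
  ~-per x q = q , refl

  ~-offset : ∀ x a b → a ℕ.< n → b ℕ.< n → x + + a ~ x + + b → a ≡ b
  ~-offset x a b a< b< (q , e) = residue-unique a b q a< b<
    (trans (lem x (+ a)) (trans (cong (_+_ (- x)) e) (lem′ x (+ b) (q * N))))
    where
    lem : ∀ x a → a ≡ - x + (x + a)
    lem = solve-∀
    lem′ : ∀ x b k → - x + (x + b + k) ≡ b + k
    lem′ = solve-∀

  res-~ : ∀ x → x ~ + res x
  res-~ x = x /ℕ n , a≡a%ℕn+[a/ℕn]*n x n

  res<n : ∀ x → res x ℕ.< n
  res<n x = n%ℕd<d x n

  ~⇒res : ∀ {x y} → x ~ y → res x ≡ res y
  ~⇒res {x} {y} x~y = let q , e = ~-trans (~-sym (res-~ x)) (~-trans x~y (res-~ y)) in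
    residue-unique (res x) (res y) q (res<n x) (res<n y) e

  res⇒~ : ∀ {x y} → res x ≡ res y → x ~ y
  res⇒~ {x} {y} e = ~-trans (res-~ x) (~-trans (~-reflexive (cong +_ e)) (~-sym (res-~ y)))

  res-small : ∀ {a} → a ℕ.< n → res (+ a) ≡ a
  res-small {a} a< = let q , e = ~-sym (res-~ (+ a)) in residue-unique _ a q (res<n (+ a)) a< e

  +suc : ∀ i → + suc i ≡ + i + 1ℤ
  +suc i = cong +_ (ℕP.+-comm 1 i)

  s : ℕ → ℤ → ℤ
  s = sGen n

  data SView (i : ℕ) (x : ℤ) : Set where
    up   : x ~ + i → s i x ≡ x + 1ℤ → SView i x
    down : x ~ + i + 1ℤ → s i x ≡ x - 1ℤ → SView i x
    miss : ¬ x ~ + i → ¬ x ~ + i + 1ℤ → s i x ≡ x → SView i x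

  sView : ∀ i x → SView i x
  sView i x with res x ℕ.≟ res (+ i) | res x ℕ.≟ res (+ suc i)
  ... | yes e | _ = up (res⇒~ e) eq
    where
    eq : s i x ≡ x + 1ℤ
    eq rewrite ≡ᵇ-true e = refl
  ... | no ne | yes e = down (subst (x ~_) (+suc i) (res⇒~ e)) eq
    where
    eq : s i x ≡ x - 1ℤ
    eq rewrite ≡ᵇ-false ne | ≡ᵇ-true e = refl
  ... | no ne | no ne′ = miss (ne ∘ ~⇒res) (ne′ ∘ ~⇒res ∘ subst (x ~_) (sym (+suc i))) eq
    where
    eq : s i x ≡ x
    eq rewrite ≡ᵇ-false ne | ≡ᵇ-false ne′ = refl

  ~-irrefl : ∀ {x y} → x ~ y → ¬ x ~ y + 1ℤ
  ~-irrefl {x} {y} p q with ~-offset y 0 1 (ℕ.s≤s ℕ.z≤n) (ℕ.s≤s (ℕ.s≤s ℕ.z≤n))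
    (~-trans (~-reflexive (ℤP.+-identityʳ y)) (~-trans (~-sym p) q))
  ... | ()

  s-up : ∀ i x → x ~ + i → s i x ≡ x + 1ℤ
  s-up i x p with sView i x
  ... | up _ e = e
  ... | down q e = ⊥-elim (~-irrefl p q)
  ... | miss ¬p _ e = ⊥-elim (¬p p)

  s-down : ∀ i x → x ~ + i + 1ℤ → s i x ≡ x - 1ℤ
  s-down i x p with sView i x
  ... | up q e = ⊥-elim (~-irrefl q p)
  ... | down _ e = e
  ... | miss _ ¬p e = ⊥-elim (¬p p)

  s-miss : ∀ i x → ¬ x ~ + i → ¬ x ~ + i + 1ℤ → s i x ≡ x
  s-miss i x ¬p ¬q with sView i x
  ... | up p e = ⊥-elim (¬p p)
  ... | down q e = ⊥-elim (¬q q)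
  ... | miss _ _ e = e

  +1-1 : ∀ x → x + 1ℤ - 1ℤ ≡ x
  +1-1 = solve-∀

  -1+1 : ∀ x → x - 1ℤ + 1ℤ ≡ x
  -1+1 = solve-∀

  s-involutive : ∀ i x → s i (s i x) ≡ x
  s-involutive i x with sView i x
  ... | up p e = trans (cong (s i) e) (trans (s-down i _ (~-+ 1ℤ p)) (+1-1 x))
  ... | down p e = trans (cong (s i) e)
    (trans (s-up i _ (subst (x - 1ℤ ~_) (+1-1 (+ i)) (~-+ -1ℤ p))) (-1+1 x))
  ... | miss _ _ e = trans (cong (s i) e) e

  Periodic : (ℤ → ℤ) → Set
  Periodic f = ∀ x q → f (x + q * N) ≡ f x + q * N

  s-periodic : ∀ i → Periodic (s i)
  s-periodic i x q with sView i x
  ... | up p e = trans (s-up i _ (~-trans (~-per x q) p)) (trans (lem x (q * N)) (cong (_+ q * N) (sym e)))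
    where
    lem : ∀ x k → x + k + 1ℤ ≡ x + 1ℤ + k
    lem = solve-∀
  ... | down p e = trans (s-down i _ (~-trans (~-per x q) p)) (trans (lem x (q * N)) (cong (_+ q * N) (sym e)))
    where
    lem : ∀ x k → x + k - 1ℤ ≡ x - 1ℤ + k
    lem = solve-∀
  ... | miss ¬p ¬q e = trans (s-miss i _ (¬p ∘ ~-trans (~-sym (~-per x q))) (¬q ∘ ~-trans (~-sym (~-per x q))))
    (cong (_+ q * N) (sym e))

  periodic-agree : ∀ {f g} → Periodic f → Periodic g → ∀ o →
    (∀ i → i ℕ.< n → f (o + + i) ≡ g (o + + i)) → ∀ x → f x ≡ g x
  periodic-agree {f} {g} pf pg o e x =
    trans (cong f x≡) (trans (pf _ q) (trans (cong (_+ q * N) (e r (res<n (x - o))))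
      (sym (trans (cong g x≡) (pg _ q)))))
    where
    r = res (x - o)
    q = _~_.quot (res-~ (x - o))
    lem : ∀ x o → x ≡ o + (x - o)
    lem = solve-∀
    x≡ : x ≡ o + + r + q * N
    x≡ = trans (lem x o) (trans (cong (_+_ o) (_~_.eq (res-~ (x - o)))) (sym (ℤP.+-assoc o (+ r) (q * N))))

  -- `W ws` is w and `P ws` is its inverse, since the letters are involutions. Left multiplication
  -- of w by a generator precomposes `P` with it, that is, it exchanges values at adjacent
  -- positions.
  W P : List ℕ → ℤ → ℤ
  W ws x = foldr s x ws
  P ws x = foldl (λ z i → s i z) x ws

  W-periodic : ∀ ws → Periodic (W ws)
  W-periodic []       x q = refl
  W-periodic (i ∷ ws) x q = trans (cong (s i) (W-periodic ws x q)) (s-periodic i (W ws x) q)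

  P-periodic : ∀ ws → Periodic (P ws)
  P-periodic []       x q = refl
  P-periodic (i ∷ ws) x q = trans (cong (P ws) (s-periodic i x q)) (P-periodic ws _ q)

  PW : ∀ ws x → P ws (W ws x) ≡ x
  PW []       x = refl
  PW (i ∷ ws) x = trans (cong (P ws) (s-involutive i _)) (PW ws x)

  WP : ∀ ws x → W ws (P ws x) ≡ x
  WP []       x = refl
  WP (i ∷ ws) x = trans (cong (s i) (WP ws _)) (s-involutive i x)

  P-injective : ∀ ws {x y} → P ws x ≡ P ws y → x ≡ y
  P-injective ws {x} {y} e = trans (sym (WP ws x)) (trans (cong (W ws) e) (WP ws y))

  P-++ : ∀ us vs x → P (us ++ vs) x ≡ P vs (P us x)
  P-++ us vs x = ListP.foldl-++ _ x us vs

  evalWord-tabulate : ∀ ws → evalWord n ws ≡ tabulate (λ j → W ws (+ suc (toℕ j)))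
  evalWord-tabulate []       = refl
  evalWord-tabulate (i ∷ ws) =
    trans (cong (Vec.map (s i)) (evalWord-tabulate ws)) (sym (VecP.tabulate-∘ (s i) (λ j → W ws (+ suc (toℕ j)))))

  evalWord⇒P : ∀ ws vs → evalWord n ws ≡ evalWord n vs → ∀ x → P ws x ≡ P vs x
  evalWord⇒P ws vs e x = trans (cong (P ws) (sym (WP vs x)))
    (trans (cong (P ws) (sym (W≡ (P vs x)))) (PW ws (P vs x)))
    where
    at : ∀ j → W ws (+ suc (toℕ j)) ≡ W vs (+ suc (toℕ j))
    at j = trans (sym (VecP.lookup∘tabulate (λ j → W ws (+ suc (toℕ j))) j)) (trans
      (cong (λ v → lookup v j) (trans (sym (evalWord-tabulate ws)) (trans e (evalWord-tabulate vs))))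
      (VecP.lookup∘tabulate (λ j → W vs (+ suc (toℕ j))) j))
    W≡ : ∀ x → W ws x ≡ W vs x
    W≡ = periodic-agree (W-periodic ws) (W-periodic vs) 1ℤ λ i i<n →
      subst (λ k → W ws (+ suc k) ≡ W vs (+ suc k)) (FinP.toℕ-fromℕ< i<n) (at (fromℕ< i<n))

  P⇒evalWord : ∀ ws vs → (∀ x → P ws x ≡ P vs x) → evalWord n ws ≡ evalWord n vs
  P⇒evalWord ws vs e = trans (evalWord-tabulate ws) (trans (VecP.tabulate-cong (λ j → W≡ (+ suc (toℕ j)))) (sym (evalWord-tabulate vs)))
    where
    W≡ : ∀ x → W ws x ≡ W vs x
    W≡ x = trans (cong (W ws) (sym (PW vs x))) (trans (cong (W ws) (sym (e (W vs x)))) (WP ws (W vs x)))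

  -- No integer moves by more than one place, so an order can be upset at distance one or two only;
  -- apart from the swapped pair itself, the residues rule out every such case.
  s-order : ∀ j {x y} → x < y → ¬ s j x < s j y → y ≡ x + 1ℤ × x ~ + j
  s-order j {x} {y} x<y ≮ with sView j x | sView j y
  ... | up p e | up _ e′ = ⊥-elim (≮ (subst₂ _<_ (sym e) (sym e′) (ℤP.+-monoˡ-< 1ℤ x<y)))
  ... | up p e | miss _ ¬q e′ with <⇒∃+ x<y
  ...   | zero  , refl = ⊥-elim (¬q (~-+ 1ℤ p))
  ...   | suc d , refl = ⊥-elim (≮ (subst₂ _<_ (sym e) (sym e′) (ℤP.+-monoʳ-< x (ℤ.+<+ (ℕ.s≤s (ℕ.s≤s ℕ.z≤n))))))
  s-order j {x} {y} x<y ≮ | up p e | down q e′ with <⇒∃+ x<y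
  ...   | zero  , refl = refl , p
  ...   | suc zero , refl = ⊥-elim (~-irrefl q
    (subst (_~ + j + 1ℤ + 1ℤ) (ℤP.+-assoc x 1ℤ 1ℤ) (~-+ 1ℤ (~-+ 1ℤ p))))
  ...   | suc (suc d) , refl =
    ⊥-elim (≮ (subst₂ _<_ (sym e) (trans (sym (ℤP.+-assoc x (+ suc (suc (suc d))) -1ℤ)) (sym e′)) (ℤP.+-monoʳ-< x (ℤ.+<+ (ℕ.s≤s (ℕ.s≤s ℕ.z≤n))))))
  s-order j {x} {y} x<y ≮ | down p e | v = ⊥-elim (≮ (subst (_< s j y) (sym e) (ℤP.<-≤-trans (ℤP.+-monoˡ-< -1ℤ x<y) (s≥ v))))
    where
    s≥ : SView j y → y - 1ℤ ≤ s j y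
    s≥ (up _ e)     = subst (y - 1ℤ ≤_) (sym e) (ℤP.+-monoʳ-≤ y ℤ.-≤+)
    s≥ (down _ e)   = ℤP.≤-reflexive (sym e)
    s≥ (miss _ _ e) = subst (y - 1ℤ ≤_) (trans (ℤP.+-identityʳ y) (sym e)) (ℤP.+-monoʳ-≤ y ℤ.-≤+)
  s-order j {x} {y} x<y ≮ | miss ¬p _ e | up _ e′ =
    ⊥-elim (≮ (subst₂ _<_ (sym e) (sym e′) (ℤP.<-trans x<y (subst (_< y + 1ℤ) (ℤP.+-identityʳ y) (ℤP.+-monoʳ-< y (ℤ.+<+ (ℕ.s≤s ℕ.z≤n)))))))
  s-order j {x} {y} x<y ≮ | miss ¬p _ e | miss _ _ e′ = ⊥-elim (≮ (subst₂ _<_ (sym e) (sym e′) x<y))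
  s-order j {x} {y} x<y ≮ | miss ¬p _ e | down q e′ with <⇒∃+ x<y
  ...   | zero  , refl = ⊥-elim (¬p (subst₂ _~_ (+1-1 x) (+1-1 (+ j)) (~-+ -1ℤ q)))
  ...   | suc d , refl = ⊥-elim (≮ (subst₂ _<_ (trans (ℤP.+-identityʳ x) (sym e))
      (trans (sym (ℤP.+-assoc x (+ suc (suc d)) -1ℤ)) (sym e′)) (ℤP.+-monoʳ-< x (ℤ.+<+ (ℕ.s≤s ℕ.z≤n)))))

  -- The letters act one at a time, so some letter is the first to reverse the pair, and by
  -- `s-order` the two images are neighbours just before it.
  first-flip : ∀ ws {x y} → x < y → P ws y < P ws x →
    ∃ λ us → ∃ λ j → ∃ λ vs → ws ≡ us ++ j ∷ vs × P us y ≡ P us x + 1ℤ × P us x ~ + j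
  first-flip []       x<y f = ⊥-elim (ℤP.<-asym x<y f)
  first-flip (j ∷ ws) {x} {y} x<y f with s j x <? s j y
  ... | no ≮ = [] , j , ws , refl , s-order j x<y ≮
  ... | yes lt with first-flip ws lt f
  ...   | us , i , vs , e , rest = j ∷ us , i , vs , cong (j ∷_) e , rest

  P-~ : ∀ us {x y} → y ~ x → P us y ~ P us x
  P-~ us {x} (q , refl) = q , P-periodic us x q

  P-~-reflects : ∀ us {x y} → P us y ~ P us x → y ~ x
  P-~-reflects us {x} (q , eq) = q , P-injective us (trans eq (sym (P-periodic us x q)))

  P-next : ∀ us {x y} → P us (x + 1ℤ) ≡ P us x + 1ℤ → y ~ x → P us (y + 1ℤ) ≡ P us y + 1ℤ
  P-next us {x} e (q , refl) = trans (cong (P us) (lem x 1ℤ (q * N))) (trans (P-periodic us _ q)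
    (trans (cong (_+ q * N) e) (trans (sym (lem (P us x) 1ℤ (q * N))) (cong (_+ 1ℤ) (sym (P-periodic us x q))))))
    where
    lem : ∀ a b c → a + c + b ≡ a + b + c
    lem = solve-∀

  -- `P us` commutes with translation by `N` and sends the swapped neighbours of s_i to those of
  -- s_j, hence it conjugates one reflection into the other.
  conjugate : ∀ us i j x → x ~ + i → P us x ~ + j → P us (x + 1ℤ) ≡ P us x + 1ℤ →
    ∀ z → s j (P us (s i z)) ≡ P us z
  conjugate us i j x x~ u~ u+ z with sView i z
  ... | up p e = let z~x = ~-trans p (~-sym x~) in
    trans (cong (s j ∘ P us) e) (trans (cong (s j) (P-next us u+ z~x))
      (trans (s-down j _ (~-+ 1ℤ (~-trans (P-~ us z~x) u~))) (+1-1 (P us z))))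
  ... | down p e = let y~x = ~-trans (subst (z - 1ℤ ~_) (+1-1 (+ i)) (~-+ -1ℤ p)) (~-sym x~) in
    trans (cong (s j ∘ P us) e) (trans (s-up j _ (~-trans (P-~ us y~x) u~))
      (trans (sym (P-next us u+ y~x)) (cong (P us) (-1+1 z))))
  ... | miss ¬p ¬q e = trans (cong (s j ∘ P us) e) (s-miss j _
    (λ h → ¬p (~-trans (P-~-reflects us (~-trans h (~-sym u~))) x~))
    (λ h → ¬q (~-trans (P-~-reflects us (subst (P us z ~_) (sym u+) (~-trans h (~-sym (~-+ 1ℤ u~))))) (~-+ 1ℤ x~))))

  -- Delete the letter found by `first-flip`: carried through the prefix by `conjugate`, the missing
  -- letter turns into s_i.
  exchange : ∀ i ws x → x ~ + i → P ws (x + 1ℤ) < P ws x →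
    ∃ λ vs → length ws ≡ suc (length vs) × (All (ℕ._< n) ws → All (ℕ._< n) vs) × (∀ z → P vs z ≡ P ws (s i z))
  exchange i ws x x~ f with first-flip ws (x<x+1 x) f
    where
    x<x+1 : ∀ x → x < x + 1ℤ
    x<x+1 x = subst (_< x + 1ℤ) (ℤP.+-identityʳ x) (ℤP.+-monoʳ-< x (ℤ.+<+ (ℕ.s≤s ℕ.z≤n)))
  ... | us , j , vs , refl , u+ , u~ = us ++ vs , len us , all us , λ z →
    trans (P-++ us vs z) (trans (cong (P vs) (sym (conjugate us i j x x~ u~ u+ z))) (sym (P-++ us (j ∷ vs) (s i z))))
    where
    len : ∀ us → length (us ++ j ∷ vs) ≡ suc (length (us ++ vs))
    len []       = refl
    len (_ ∷ us) = cong suc (len us)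
    all : ∀ us → All (ℕ._< n) (us ++ j ∷ vs) → All (ℕ._< n) (us ++ vs)
    all []       (_ ∷ a) = a
    all (_ ∷ us) (p ∷ a) = p ∷ all us a

-- Runs of a carrier along a word of drops (false) and passes (true)

count : List Bool → ℕ
count []           = 0
count (true  ∷ bs) = suc (count bs)
count (false ∷ bs) = count bs

count-∷ʳ : ∀ bs b → count (bs ∷ʳ b) ≡ count (b ∷ bs)
count-∷ʳ []           b     = refl
count-∷ʳ (false ∷ bs) true  = count-∷ʳ bs true
count-∷ʳ (false ∷ bs) false = count-∷ʳ bs false
count-∷ʳ (true ∷ bs)  true  = cong suc (count-∷ʳ bs true)
count-∷ʳ (true ∷ bs)  false = cong suc (count-∷ʳ bs false)

count<⇒false∈ : ∀ bs → count bs ℕ.< length bs → false ∈ bs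
count<⇒false∈ (false ∷ bs) _ = here refl
count<⇒false∈ (true ∷ bs) (ℕ.s≤s lt) = there (count<⇒false∈ bs lt)

data Run : List Bool → ℤ → List ℤ → List ℤ → ℤ → Set where
  stop : ∀ {c} → Run [] c [] [] c
  cut  : ∀ {bs c x xs ys e} → Run bs x xs ys e → Run (false ∷ bs) c (x ∷ xs) (c ∷ ys) e
  pass : ∀ {bs c x xs ys e} → c < x → Run bs c xs ys e → Run (true ∷ bs) c (x ∷ xs) (x ∷ ys) e

Run-functional : ∀ {bs c xs ys e ys′ e′} → Run bs c xs ys e → Run bs c xs ys′ e′ → ys ≡ ys′ × e ≡ e′
Run-functional stop       stop        = refl , refl
Run-functional (cut r)    (cut r′)    with Run-functional r r′
... | refl , refl = refl , refl
Run-functional (pass _ r) (pass _ r′) with Run-functional r r′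
... | refl , refl = refl , refl

-- At the first drop the starting hand is put down, and nothing later depends on it. Since a closed
-- run ends at `c + N`, its start is thereby unique.
Run-end-unique : ∀ {bs c d xs ys e ys′ e′} → false ∈ bs → Run bs c xs ys e → Run bs d xs ys′ e′ → e ≡ e′
Run-end-unique (here refl) (cut r)    (cut r′)    = proj₂ (Run-functional r r′)
Run-end-unique (there f∈)  (cut r)    (cut r′)    = proj₂ (Run-functional r r′)
Run-end-unique (there f∈)  (pass _ r) (pass _ r′) = Run-end-unique f∈ r r′

Run-end : ∀ {bs c xs ys e} → Run bs c xs ys e → e ∈ c ∷ xs
Run-end stop    = here refl
Run-end (cut r) = there (Run-end r)
Run-end (pass _ r) with Run-end r
... | here e≡c  = here e≡c
... | there e∈  = there (there e∈)

Run-outputs : ∀ {bs c xs ys e z} → Run bs c xs ys e → z ∈ ys → z ∈ c ∷ xs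
Run-outputs (cut r)    (here refl) = here refl
Run-outputs (cut r)    (there z∈)  = there (Run-outputs r z∈)
Run-outputs (pass _ r) (here refl) = there (here refl)
Run-outputs (pass _ r) (there z∈) with Run-outputs r z∈
... | here z≡c = here z≡c
... | there z∈ = there (there z∈)

Run-shift : ∀ q {bs c xs ys e} → Run bs c xs ys e → Run bs (c + q) (map (_+ q) xs) (map (_+ q) ys) (e + q)
Run-shift q stop       = stop
Run-shift q (cut r)    = cut (Run-shift q r)
Run-shift q (pass l r) = pass (ℤP.+-monoˡ-< q l) (Run-shift q r)

Run-∷ʳ-cut : ∀ {bs c xs ys e} z → Run bs c xs ys e → Run (bs ∷ʳ false) c (xs ∷ʳ z) (ys ∷ʳ e) z
Run-∷ʳ-cut z stop       = cut stop
Run-∷ʳ-cut z (cut r)    = cut (Run-∷ʳ-cut z r)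
Run-∷ʳ-cut z (pass l r) = pass l (Run-∷ʳ-cut z r)

Run-∷ʳ-pass : ∀ {bs c xs ys e z} → e < z → Run bs c xs ys e → Run (bs ∷ʳ true) c (xs ∷ʳ z) (ys ∷ʳ z) e
Run-∷ʳ-pass e<z stop       = pass e<z stop
Run-∷ʳ-pass e<z (cut r)    = cut (Run-∷ʳ-pass e<z r)
Run-∷ʳ-pass e<z (pass l r) = pass l (Run-∷ʳ-pass e<z r)

-- The first decision moves to the end, where the same two values meet again, translated by `N`.
Run-rotate : ∀ N {b bs c x xs y ys} → Run (b ∷ bs) c (x ∷ xs) (y ∷ ys) (c + N) →
  ∃ λ c′ → Run (bs ∷ʳ b) c′ (xs ∷ʳ (x + N)) (ys ∷ʳ (y + N)) (c′ + N)
Run-rotate N (cut r)    = _ , Run-∷ʳ-cut _ r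
Run-rotate N (pass l r) = _ , Run-∷ʳ-pass (ℤP.+-monoˡ-< N l) r

-- Bit strings, sorting runs and subsets by their decisions

bitStrings : ℕ → List (List Bool)
bitStrings zero    = [] ∷ []
bitStrings (suc r) = map (true ∷_) (bitStrings r) ++ map (false ∷_) (bitStrings r)

Σ-bitStrings-suc : ∀ r (F : List Bool → ℤ) → Σl (bitStrings (suc r)) F ≡
  Σl (bitStrings r) (F ∘ (true ∷_)) + Σl (bitStrings r) (F ∘ (false ∷_))
Σ-bitStrings-suc r F = trans (Σl-++ (map (true ∷_) (bitStrings r)) _ F)
  (cong₂ _+_ (Σl-map (true ∷_) (bitStrings r) F) (Σl-map (false ∷_) (bitStrings r) F))

rotate : List Bool → List Bool
rotate []       = []
rotate (b ∷ bs) = bs ∷ʳ b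

Σ-bitStrings-∷ʳ : ∀ r (F : List Bool → ℤ) → Σl (bitStrings (suc r)) F ≡
  Σl (bitStrings r) (F ∘ (_∷ʳ true)) + Σl (bitStrings r) (F ∘ (_∷ʳ false))
Σ-bitStrings-∷ʳ zero    F = Σ-bitStrings-suc zero F
Σ-bitStrings-∷ʳ (suc r) F = trans (Σ-bitStrings-suc (suc r) F)
  (trans (cong₂ _+_ (Σ-bitStrings-∷ʳ r (F ∘ (true ∷_))) (Σ-bitStrings-∷ʳ r (F ∘ (false ∷_))))
  (trans (interchange (Σl (bitStrings r) (F ∘ (true ∷_) ∘ (_∷ʳ true))) _ _ _)
  (sym (cong₂ _+_ (Σ-bitStrings-suc r (F ∘ (_∷ʳ true))) (Σ-bitStrings-suc r (F ∘ (_∷ʳ false)))))))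
  where
  interchange : ∀ a b c d → (a + b) + (c + d) ≡ (a + c) + (b + d)
  interchange = solve-∀

Σ-rotate : ∀ r (F : List Bool → ℤ) → Σl (bitStrings r) (F ∘ rotate) ≡ Σl (bitStrings r) F
Σ-rotate zero    F = refl
Σ-rotate (suc r) F = trans (Σ-bitStrings-suc r (F ∘ rotate)) (sym (Σ-bitStrings-∷ʳ r F))

bitStrings-length : ∀ r {bs} → bs ∈ bitStrings r → length bs ≡ r
bitStrings-length zero (here refl) = refl
bitStrings-length (suc r) bs∈ with ∈P.∈-++⁻ (map (true ∷_) (bitStrings r)) bs∈
... | inj₁ p with ∈P.∈-map⁻ (true ∷_) p
...   | _ , p′ , refl = cong suc (bitStrings-length r p′)
bitStrings-length (suc r) bs∈ | inj₂ p with ∈P.∈-map⁻ (false ∷_) p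
...   | _ , p′ , refl = cong suc (bitStrings-length r p′)

-- The part of `row` with all decisions prescribed; the default 0 covers bit strings of the wrong
-- length.
runSum : List Bool → List ℤ → (List ℤ → ℤ → ℕ → ℤ) → ℤ → ℕ → ℤ
runSum []           []       G c k = G [] c k
runSum (false ∷ bs) (x ∷ xs) G c k = runSum bs xs (λ ys → G (c ∷ ys)) x k
runSum (true  ∷ bs) (x ∷ xs) G c k = [ c <ᵇ x ]· runSum bs xs (λ ys → G (x ∷ ys)) c (suc k)
runSum _            _        G c k = 0ℤ

row-bitStrings : ∀ xs G c k → row xs G c k ≡ (Σ[ bs ← bitStrings (length xs) ] runSum bs xs G c k)
row-bitStrings []       G c k = sym (ℤP.+-identityʳ _)
row-bitStrings (x ∷ xs) G c k = trans
  (cong₂ _+_ (row-bitStrings xs (λ ys → G (c ∷ ys)) x k)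
    (trans (cong ([ c <ᵇ x ]·_) (row-bitStrings xs (λ ys → G (x ∷ ys)) c (suc k)))
           (sym (Σl-[]· (c <ᵇ x) (bitStrings (length xs)) _))))
  (trans (ℤP.+-comm (Σl (bitStrings (length xs)) (λ bs → runSum bs xs (λ ys → G (c ∷ ys)) x k)) _)
    (sym (Σ-bitStrings-suc (length xs) (λ bs → runSum bs (x ∷ xs) G c k))))

runSum-Run : ∀ {bs c xs ys e} G k → Run bs c xs ys e → runSum bs xs G c k ≡ G ys e (k ℕ.+ count bs)
runSum-Run G k stop = cong (G [] _) (sym (ℕP.+-identityʳ k))
runSum-Run {c = c} G k (cut r) = runSum-Run (λ ys → G (c ∷ ys)) k r
runSum-Run {bs = true ∷ bs} {xs = x ∷ _} G k (pass l r) rewrite <ᵇ-true l =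
  trans (runSum-Run (λ ys → G (x ∷ ys)) (suc k) r) (cong (G _ _) (sym (ℕP.+-suc k (count bs))))

runSum-0 : ∀ bs xs G c k → (∀ ys e → Run bs c xs ys e → G ys e (k ℕ.+ count bs) ≡ 0ℤ) → runSum bs xs G c k ≡ 0ℤ
runSum-0 []           []       G c k h = trans (cong (G [] c) (sym (ℕP.+-identityʳ k))) (h [] c stop)
runSum-0 (false ∷ bs) (x ∷ xs) G c k h = runSum-0 bs xs _ x k (λ ys e r → h (c ∷ ys) e (cut r))
runSum-0 (true  ∷ bs) (x ∷ xs) G c k h with c <? x
... | yes c<x = runSum-0 bs xs _ c (suc k) (λ ys e r →
  trans (cong (G (x ∷ ys) e) (sym (ℕP.+-suc k (count bs)))) (h (x ∷ ys) e (pass c<x r)))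
... | no _    = refl
runSum-0 []           (_ ∷ _)  G c k h = refl
runSum-0 (false ∷ _)  []       G c k h = refl
runSum-0 (true ∷ _)   []       G c k h = refl

select : List Bool → List A → List A
select (true  ∷ bs) (x ∷ xs) = x ∷ select bs xs
select (false ∷ bs) (x ∷ xs) = select bs xs
select _            _        = []

Σ-choose : ∀ k xs (F : List ℕ → ℤ) → Σl (choose k xs) F ≡
  (Σ[ bs ← bitStrings (length xs) ] [ does (count bs ℕ.≟ k) ]· F (select bs xs))
Σ-choose zero    []       F = refl
Σ-choose (suc k) []       F = refl
Σ-choose zero    (x ∷ xs) F = trans (Σ-choose zero xs F) (sym (trans
  (Σ-bitStrings-suc (length xs) (λ bs → [ does (count bs ℕ.≟ 0) ]· F (select bs (x ∷ xs))))
  (trans (cong (_+ Σl (bitStrings (length xs)) (λ bs → [ does (count bs ℕ.≟ 0) ]· F (select bs xs)))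
           (Σl-0 (bitStrings (length xs)))) (ℤP.+-identityˡ _))))
Σ-choose (suc k) (x ∷ xs) F = trans (Σl-++ (map (x ∷_) (choose k xs)) (choose (suc k) xs) F)
  (trans (cong₂ _+_ (trans (Σl-map (x ∷_) (choose k xs) F) (Σ-choose k xs (F ∘ (x ∷_)))) (Σ-choose (suc k) xs F))
  (sym (Σ-bitStrings-suc (length xs) (λ bs → [ does (count bs ℕ.≟ suc k) ]· F (select bs (x ∷ xs))))))

choose-select : ∀ k xs {A} → A ∈ choose k xs → ∃ λ bs → length bs ≡ length xs × count bs ≡ k × A ≡ select bs xs
choose-select zero [] (here refl) = [] , refl , refl , refl
choose-select zero (x ∷ xs) (here refl) with choose-select zero xs (here refl)
... | bs , l , c , e = false ∷ bs , cong suc l , c , e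
choose-select (suc k) (x ∷ xs) A∈ with ∈P.∈-++⁻ (map (x ∷_) (choose k xs)) A∈
... | inj₁ p with ∈P.∈-map⁻ (x ∷_) p
...   | _ , p′ , refl with choose-select k xs p′
...     | bs , l , c , e = true ∷ bs , cong suc l , cong suc c , cong (x ∷_) e
choose-select (suc k) (x ∷ xs) A∈ | inj₂ p with choose-select (suc k) xs p
...   | bs , l , c , e = false ∷ bs , cong suc l , c , e

-- Closed runs and their contribution to the trace

==-false : ∀ {c e : ℤ} → c ≢ e → (c == e) ≡ false
==-false {c} {e} c≢e with c ≟ e
... | yes c≡e = ⊥-elim (c≢e c≡e)
... | no _    = refl

module _ {N : ℤ} (N≢0 : N ≢ 0ℤ) where

  c+N≢c : ∀ c → c + N ≢ c
  c+N≢c c e = N≢0 (∙-cancelˡ c N 0ℤ (trans e (sym (ℤP.+-identityʳ c))))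

  closed-end : ∀ {bs c xs ys} → Run bs c xs ys (c + N) → c + N ∈ xs
  closed-end {c = c} r with Run-end r
  ... | here e   = ⊥-elim (c+N≢c c e)
  ... | there e∈ = e∈

  closed-cuts : ∀ {bs c xs ys} → Run bs c xs ys (c + N) → false ∈ bs
  closed-cuts {c = c} r = go (c+N≢c c) r
    where
    go : ∀ {bs c xs ys e} → e ≢ c → Run bs c xs ys e → false ∈ bs
    go e≢c stop       = ⊥-elim (e≢c refl)
    go e≢c (cut _)    = here refl
    go e≢c (pass _ r) = there (go e≢c r)

module _ (N : ℤ) (S : List ℤ) where
  open Trace N S

  runTrace : ℕ → (List ℤ → ℤ) → List ℤ → List Bool → ℤ
  runTrace K φ xs bs = Σ[ c ← S ] runSum bs xs (λ ys e k → [ e == c + N ]· [ does (k ℕ.≟ K) ]· φ ys) c 0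

  transfer-bitStrings : ∀ K φ xs → transfer K φ xs ≡ Σl (bitStrings (length xs)) (runTrace K φ xs)
  transfer-bitStrings K φ xs = trans (Σl-cong S (λ c _ → row-bitStrings xs _ c 0))
    (Σl-swap S (bitStrings (length xs)) (λ c bs → runSum bs xs _ c 0))

  runTrace-none : ∀ K φ xs bs → (∀ c ys → ¬ Run bs c xs ys (c + N)) → runTrace K φ xs bs ≡ 0ℤ
  runTrace-none K φ xs bs none = trans (Σl-cong S (λ c _ → runSum-0 bs xs _ c 0 (zero-at c))) (Σl-0 S)
    where
    zero-at : ∀ c ys e → Run bs c xs ys e → [ e == c + N ]· [ does (count bs ℕ.≟ K) ]· φ ys ≡ 0ℤ
    zero-at c ys e r rewrite ==-false {e} {c + N} (λ { refl → none c ys r }) = refl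

  runTrace-count : ∀ K φ xs bs → count bs ≢ K → runTrace K φ xs bs ≡ 0ℤ
  runTrace-count K φ xs bs c≢K = trans (Σl-cong S (λ c _ → runSum-0 bs xs _ c 0 (zero-at c))) (Σl-0 S)
    where
    zero-at : ∀ c ys e → Run bs c xs ys e → [ e == c + N ]· [ does (count bs ℕ.≟ K) ]· φ ys ≡ 0ℤ
    zero-at c ys e r rewrite ≡ᵇ-false c≢K with e == c + N
    ... | true  = refl
    ... | false = refl

  -- A closed run contains a drop, so by `Run-end-unique` no other hand closes up on the same bits,
  -- and a duplicate-free `S` counts it exactly once.
  runTrace-Run : N ≢ 0ℤ → ∀ K φ xs bs {c ys} → Unique S → c ∈ S → Run bs c xs ys (c + N) →
    runTrace K φ xs bs ≡ [ does (count bs ℕ.≟ K) ]· φ ys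
  runTrace-Run N≢0 K φ xs bs {c} {ys} unique c∈ r = trans
    (Σl-single S _ unique c∈ (λ d d≢c → runSum-0 bs xs _ d 0 (zero-at d d≢c)))
    (trans (runSum-Run _ 0 r) at-c)
    where
    at-c : [ c + N == c + N ]· [ does (count bs ℕ.≟ K) ]· φ ys ≡ [ does (count bs ℕ.≟ K) ]· φ ys
    at-c with c + N ≟ c + N
    ... | yes _ = refl
    ... | no ¬p = ⊥-elim (¬p refl)
    zero-at : ∀ d → d ≢ c → ∀ zs e → Run bs d xs zs e → [ e == d + N ]· [ does (count bs ℕ.≟ K) ]· φ zs ≡ 0ℤ
    zero-at d d≢c zs e r′ rewrite ==-false {e} {d + N}
      (λ { refl → d≢c (∙-cancelʳ N d c (Run-end-unique (closed-cuts N≢0 r) r′ r)) }) = refl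

-- Lists, subsets and words

foldl-filter : {P : A → Set} (P? : ∀ x → Dec (P x)) (f : B → A → B) (v : B) (xs : List A) →
  foldl f v (filter P? xs) ≡ foldl (λ v x → if does (P? x) then f v x else v) v xs
foldl-filter P? f v [] = refl
foldl-filter {P = P} P? f v (x ∷ xs) with P? x
... | yes _ = foldl-filter P? f (f v x) xs
... | no _  = foldl-filter P? f v xs

foldl-cong : {f g : B → A → B} → (∀ v x → f v x ≡ g v x) → ∀ v xs → foldl f v xs ≡ foldl g v xs
foldl-cong e v []       = refl
foldl-cong {g = g} e v (x ∷ xs) = trans (cong (λ v → foldl _ v xs) (e v x)) (foldl-cong e (g v x) xs)

applyUpTo-cong : {f g : ℕ → A} → ∀ r → (∀ i → i ℕ.< r → f i ≡ g i) → applyUpTo f r ≡ applyUpTo g r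
applyUpTo-cong zero    e = refl
applyUpTo-cong (suc r) e = cong₂ _∷_ (e 0 (ℕ.s≤s ℕ.z≤n)) (applyUpTo-cong r (λ i i<r → e (suc i) (ℕ.s≤s i<r)))

win-applyUpTo : ∀ (f : ℤ → A) o r → win f o r ≡ applyUpTo (λ i → f (o + + i)) r
win-applyUpTo f o zero    = refl
win-applyUpTo f o (suc r) = cong₂ _∷_ (cong f (sym (ℤP.+-identityʳ o)))
  (trans (win-applyUpTo f (o + 1ℤ) r) (applyUpTo-cong r (λ i _ → cong f (shift-1 o i))))

win-length : ∀ (f : ℤ → A) o r → length (win f o r) ≡ r
win-length f o zero    = refl
win-length f o (suc r) = cong suc (win-length f (o + 1ℤ) r)

win-∈ : ∀ {A : Set} (f : ℤ → A) o r {z} → z ∈ win f o r → ∃ λ x → z ≡ f x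
win-∈ f o (suc r) (here e)   = o , e
win-∈ f o (suc r) (there z∈) = win-∈ f (o + 1ℤ) r z∈

win-map : (g : A → B) (f : ℤ → A) → ∀ o r → map g (win f o r) ≡ win (g ∘ f) o r
win-map g f o zero    = refl
win-map g f o (suc r) = cong (g (f o) ∷_) (win-map g f (o + 1ℤ) r)

win-shift : (f g : ℤ → A) → ∀ k → (∀ x → f (x + k) ≡ g x) → ∀ o r → win f (o + k) r ≡ win g o r
win-shift f g k e o zero    = refl
win-shift f g k e o (suc r) = cong₂ _∷_ (e o)
  (trans (cong (λ z → win f z r) (lem o k)) (win-shift f g k e (o + 1ℤ) r))
  where
  lem : ∀ o k → o + k + 1ℤ ≡ o + 1ℤ + k
  lem = solve-∀

-- The search inside `firstOut` is a local function, so the lemma speaks of any `g` obeying its two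
-- equations.
firstJust : ∀ {A} (g : List ℕ → Maybe ℕ) → g [] ≡ nothing →
  (∀ j js → g (j ∷ js) ≡ (if memb j A then g js else just j)) →
  ∀ xs {i} → i ∈ xs → memb i A ≡ false → ∃ λ j → g xs ≡ just j × j ∈ xs × memb j A ≡ false
firstJust {A} g g[] g∷ (x ∷ xs) i∈ i∉A with memb x A in mx
... | false = x , trans (g∷ x xs) (cong (λ b → if b then g xs else just x) mx) , here refl , mx
firstJust {A} g g[] g∷ (x ∷ xs) (here refl) i∉A | true with () ← trans (sym mx) i∉A
firstJust {A} g g[] g∷ (x ∷ xs) (there i∈) i∉A | true with firstJust {A} g g[] g∷ xs i∈ i∉A
... | j , e , j∈ , mj = j , trans (g∷ x xs) (trans (cong (λ b → if b then g xs else just x) mx) e) , there j∈ , mj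

firstOut-just : ∀ n A {i} → i ℕ.< n → memb i A ≡ false →
  ∃ λ j → firstOut n A ≡ just j × j ℕ.< n × memb j A ≡ false
firstOut-just n A i<n i∉A = let j , e , j∈ , j∉A = search n A (∈P.∈-upTo⁺ i<n) i∉A in j , e , ∈P.∈-upTo⁻ j∈ , j∉A
  where
  search : ∀ n A {i} → i ∈ upTo n → memb i A ≡ false →
    ∃ λ j → firstOut n A ≡ just j × j ∈ upTo n × memb j A ≡ false
  search n A with upTo n | firstJust {A} _ refl (λ _ _ → refl)
  ... | xs | first = first xs

memb-here : ∀ {a m} A → a ≡ m → memb m (a ∷ A) ≡ true
memb-here {a} A refl rewrite ≡ᵇ-true {a} refl = refl

memb-there : ∀ {a m} A → a ≢ m → memb m (a ∷ A) ≡ memb m A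
memb-there A a≢m rewrite ≡ᵇ-false a≢m = refl

memb-select : ∀ (f : ℕ → ℕ) → (∀ i j → f i ≡ f j → i ≡ j) → ∀ bs →
  applyUpTo (λ i → memb (f i) (select bs (applyUpTo f (length bs)))) (length bs) ≡ bs
memb-select f inj [] = refl
memb-select f inj (true ∷ bs) = cong₂ _∷_ (memb-here rest refl)
  (trans (applyUpTo-cong (length bs) (λ i _ → memb-there rest (ℕP.0≢1+n ∘ inj 0 (suc i))))
    (memb-select (f ∘ suc) (λ i j → ℕP.suc-injective ∘ inj (suc i) (suc j)) bs))
  where rest = select bs (applyUpTo (f ∘ suc) (length bs))
memb-select f inj (false ∷ bs) = cong₂ _∷_ (absent f bs (f 0) (λ i → ℕP.0≢1+n ∘ inj 0 (suc i) ∘ sym))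
  (memb-select (f ∘ suc) (λ i j → ℕP.suc-injective ∘ inj (suc i) (suc j)) bs)
  where
  absent : ∀ (f : ℕ → ℕ) bs m → (∀ i → f (suc i) ≢ m) → memb m (select bs (applyUpTo (f ∘ suc) (length bs))) ≡ false
  absent f []           m ne = refl
  absent f (true ∷ bs)  m ne = trans (memb-there (select bs (applyUpTo (f ∘ suc ∘ suc) (length bs))) (ne 0))
    (absent (f ∘ suc) bs m (ne ∘ suc))
  absent f (false ∷ bs) m ne = absent (f ∘ suc) bs m (ne ∘ suc)

wordsOfLength-complete : ∀ n ws → All (ℕ._< n) ws → ws ∈ wordsOfLength n (length ws)
wordsOfLength-complete n []       []       = here refl
wordsOfLength-complete n (i ∷ ws) (p ∷ ps) =
  ∈P.∈-concatMap⁺ (λ i → map (i ∷_) (wordsOfLength n (length ws))) (Any.map (λ { refl → ∈P.∈-map⁺ (i ∷_) (wordsOfLength-complete n ws ps) }) (∈P.∈-upTo⁺ p))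

wordsOfLength-sound : ∀ n k {ws} → ws ∈ wordsOfLength n k → length ws ≡ k × All (ℕ._< n) ws
wordsOfLength-sound n zero    (here refl) = refl , []
wordsOfLength-sound n (suc k) ws∈ with find (∈P.∈-concatMap⁻ (λ i → map (i ∷_) (wordsOfLength n k)) {xs = upTo n} ws∈)
... | i , i∈ , p with ∈P.∈-map⁻ (i ∷_) p
...   | vs , q , refl = let l , a = wordsOfLength-sound n k q in cong suc l , ∈P.∈-upTo⁻ i∈ ∷ a

wordsUpTo-complete : ∀ n k ws → All (ℕ._< n) ws → length ws ℕ.≤ k → ws ∈ wordsUpTo n k
wordsUpTo-complete n k ws ps l =
  ∈P.∈-concatMap⁺ (wordsOfLength n) (Any.map (λ { refl → wordsOfLength-complete n ws ps }) (∈P.∈-upTo⁺ (ℕ.s≤s l)))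

wordsUpTo-sound : ∀ n k {ws} → ws ∈ wordsUpTo n k → length ws ℕ.≤ k × All (ℕ._< n) ws
wordsUpTo-sound n k ws∈ with find (∈P.∈-concatMap⁻ (wordsOfLength n) {xs = upTo (suc k)} ws∈)
... | i , i∈ , p = let l , a = wordsOfLength-sound n i p in
  subst (ℕ._≤ k) (sym l) (ℕP.≤-pred (∈P.∈-upTo⁻ i∈)) , a

lengthAtMost-true : ∀ n w k ws → All (ℕ._< n) ws → length ws ℕ.≤ k → evalWord n ws ≡ w → lengthAtMost n w k ≡ true
lengthAtMost-true n w k ws ps l e = any-true _ (wordsUpTo-complete n k ws ps l) (==W-true e)
  where
  ==W-true : ∀ {n} {v w : Window n} → v ≡ w → (v ==W w) ≡ true
  ==W-true {v = v} {w} v≡w with VecP.≡-dec ℤ._≟_ v w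
  ... | yes _ = refl
  ... | no ne = ⊥-elim (ne v≡w)
  any-true : ∀ (p : A → Bool) {x xs} → x ∈ xs → p x ≡ true → any p xs ≡ true
  any-true p {xs = x ∷ xs} (here refl) px rewrite px = refl
  any-true p {xs = y ∷ xs} (there x∈) px with p y
  ... | true  = refl
  ... | false = any-true p x∈ px

lengthAtMost-word : ∀ n w k → lengthAtMost n w k ≡ true →
  ∃ λ ws → All (ℕ._< n) ws × length ws ℕ.≤ k × evalWord n ws ≡ w
lengthAtMost-word n w k e = let ws , ws∈ , p = any-witness _ (wordsUpTo n k) e
                                l , a = wordsUpTo-sound n k ws∈ in ws , a , l , ==W-eq p
  where
  ==W-eq : ∀ {n} {v w : Window n} → (v ==W w) ≡ true → v ≡ w
  ==W-eq {v = v} {w} _ with VecP.≡-dec ℤ._≟_ v w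
  ... | yes p = p
  any-witness : ∀ (p : A → Bool) xs → any p xs ≡ true → ∃ λ x → x ∈ xs × p x ≡ true
  any-witness p (x ∷ xs) e with p x in px
  ... | true  = x , here refl , px
  ... | false = let y , y∈ , py = any-witness p xs e in y , there y∈ , py

-- The action of the generators on reduced words

module Action (n-2 : ℕ) where
  open Affine n-2

  -- Certifies that the tag is the Coxeter length, so that the bounded search in `uTerm` really
  -- decides whether s_i lengthens w.
  record Reduced (t : Term n) (ws : List ℕ) : Set where
    field
      evaluates : evalWord n ws ≡ proj₁ t
      letters   : All (ℕ._< n) ws
      length≡   : length ws ≡ proj₂ t
      shortest  : ∀ vs → All (ℕ._< n) vs → evalWord n vs ≡ proj₁ t → proj₂ t ℕ.≤ length vs

  open Reduced

  Descent Ascent : List ℕ → ℤ → Set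
  Descent ws x = P ws (x + 1ℤ) < P ws x
  Ascent  ws x = P ws x < P ws (x + 1ℤ)

  x≢x+1 : ∀ x → x ≢ x + 1ℤ
  x≢x+1 x e = ~-irrefl ~-refl (~-reflexive e)

  ascent⊎descent : ∀ ws x → Ascent ws x ⊎ Descent ws x
  ascent⊎descent ws x with ℤP.<-cmp (P ws x) (P ws (x + 1ℤ))
  ... | tri< a _ _ = inj₁ a
  ... | tri≈ _ e _ = ⊥-elim (x≢x+1 x (P-injective ws e))
  ... | tri> _ _ d = inj₂ d

  P-∷-up : ∀ i ws {x} → x ~ + i → P (i ∷ ws) x ≡ P ws (x + 1ℤ)
  P-∷-up i ws {x} p = cong (P ws) (s-up i x p)

  P-∷-down : ∀ i ws {x} → x ~ + i → P (i ∷ ws) (x + 1ℤ) ≡ P ws x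
  P-∷-down i ws {x} p = cong (P ws) (trans (s-down i (x + 1ℤ) (~-+ 1ℤ p)) (+1-1 x))

  -- `exchange` yields a word for s_i w with one letter fewer than `ws`, and the search in `uTerm`
  -- finds it.
  uTerm-descent : ∀ {t ws} i {x} → Reduced t ws → i ℕ.< n → x ~ + i → Descent ws x → uTerm n i t ≡ []
  uTerm-descent {t} {ws} i {x} red i<n x~ d
    with vs , l , a , e ← exchange i ws x x~ d
    rewrite lengthAtMost-true n (leftMul n i (proj₁ t)) (proj₂ t) vs (a (letters red))
      (subst (length vs ℕ.≤_) (length≡ red) (subst (length vs ℕ.≤_) (sym l) (ℕP.n≤1+n _)))
      (trans (P⇒evalWord vs (i ∷ ws) e) (cong (leftMul n i) (evaluates red))) = refl

  -- Any word for s_i w has a descent at `x`; `exchange` shortens it by one letter to a word for w,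
  -- where minimality applies.
  ascent-lengthens : ∀ {t ws} i {x} → Reduced t ws → x ~ + i → Ascent ws x →
    ∀ vs → All (ℕ._< n) vs → evalWord n vs ≡ leftMul n i (proj₁ t) → proj₂ t ℕ.< length vs
  ascent-lengthens {t} {ws} i {x} red x~ asc vs a e =
    let us , l , b , e′ = exchange i vs x x~ (subst₂ _<_
          (trans (sym (P-∷-down i ws x~)) (sym (P≡ (x + 1ℤ)))) (trans (sym (P-∷-up i ws x~)) (sym (P≡ x))) asc)
    in subst (proj₂ t ℕ.<_) (sym l) (ℕ.s≤s (shortest red us (b a)
         (trans (P⇒evalWord us ws (λ z → trans (e′ z) (trans (P≡ (s i z)) (cong (P ws) (s-involutive i z))))) (evaluates red))))
    where
    P≡ : ∀ z → P vs z ≡ P (i ∷ ws) z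
    P≡ = evalWord⇒P vs (i ∷ ws) (trans e (sym (cong (leftMul n i) (evaluates red))))

  uTerm-ascent : ∀ {t ws} i {x} → Reduced t ws → i ℕ.< n → x ~ + i → Ascent ws x →
    uTerm n i t ≡ (leftMul n i (proj₁ t) , suc (proj₂ t)) ∷ [] ×
    Reduced (leftMul n i (proj₁ t) , suc (proj₂ t)) (i ∷ ws)
  uTerm-ascent {t} {ws} i red i<n x~ asc = acts , record
    { evaluates = cong (leftMul n i) (evaluates red)
    ; letters   = i<n ∷ letters red
    ; length≡   = cong suc (length≡ red)
    ; shortest  = ascent-lengthens i red x~ asc
    }
    where
    acts : uTerm n i t ≡ (leftMul n i (proj₁ t) , suc (proj₂ t)) ∷ []
    acts with lengthAtMost n (leftMul n i (proj₁ t)) (proj₂ t) in e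
    ... | false = refl
    ... | true  = let vs , a , l , e′ = lengthAtMost-word n _ _ e in
      ⊥-elim (ℕP.<⇒≱ (ascent-lengthens i red x~ asc vs a e′) l)

  -- The carrier turns p, read from o + 1, into ys, read from o; after one turn around the circle
  -- it must hold the periodic translate of what it held at the start.
  Cycle : (ℤ → Bool) → (ℤ → ℤ) → List ℤ → ℤ → Set
  Cycle α p ys o = ∃ λ c → Run (win α o n) c (win p (o + 1ℤ) n) ys (c + N)

  Invariant : (ℤ → Bool) → Set
  Invariant α = ∀ x q → α (x + q * N) ≡ α x

  Periodic-+N : ∀ {f} → Periodic f → ∀ x → f (x + N) ≡ f x + N
  Periodic-+N {f} pf x = subst (λ k → f (x + k) ≡ f x + k) (ℤP.*-identityˡ N) (pf x 1ℤ)

  Invariant-+N : ∀ {α} → Invariant α → ∀ x → α (x + N) ≡ α x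
  Invariant-+N {α} iα x = subst (λ k → α (x + k) ≡ α x) (ℤP.*-identityˡ N) (iα x 1ℤ)

  win-rotate : ∀ {A : Set} (f : ℤ → A) o → win f (o + 1ℤ) n ≡ win f (o + 1ℤ) (suc n-2) ∷ʳ f (o + N)
  win-rotate f o = trans (win-∷ʳ f (o + 1ℤ) (suc n-2)) (cong (λ z → win f (o + 1ℤ) (suc n-2) ∷ʳ f z) (shift-1 o (suc n-2)))

  -- A run writes a bare list. This remembers which periodic sequence the list belongs to when the
  -- starting place is moved.
  _TransportsTo_ : List ℤ × ℤ → List ℤ × ℤ → Set
  (ys , a) TransportsTo (ys′ , b) = ∀ q → Periodic q → ys ≡ win q a n → ys′ ≡ win q b n

  Cycle-+1 : ∀ {α p} → Invariant α → Periodic p → ∀ {ys} o → Cycle α p ys o →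
    ∃ λ ys′ → Cycle α p ys′ (o + 1ℤ) × (ys , o) TransportsTo (ys′ , o + 1ℤ)
  Cycle-+1 {α} {p} iα pp {y ∷ ys} o (c , r) with Run-rotate N r
  ... | c′ , r′ = ys ∷ʳ (y + N) ,
    (c′ , subst₂ (λ bs xs → Run bs c′ xs (ys ∷ʳ (y + N)) (c′ + N))
      (sym (trans (win-rotate α o) (cong (win α (o + 1ℤ) (suc n-2) ∷ʳ_) (Invariant-+N iα o))))
      (sym (trans (win-rotate p (o + 1ℤ)) (cong (win p (o + 1ℤ + 1ℤ) (suc n-2) ∷ʳ_) (Periodic-+N {p} pp (o + 1ℤ))))) r′) ,
    λ { q pq refl → sym (trans (win-rotate q o) (cong (win q (o + 1ℤ) (suc n-2) ∷ʳ_) (Periodic-+N {q} pq o))) }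
  Cycle-+1 iα pp {[]} o (c , r) with () ← r

  win-Periodic : ∀ {f} → Periodic f → ∀ q o r → win f (o + q * N) r ≡ map (_+ q * N) (win f o r)
  win-Periodic {f} pf q o r =
    trans (win-shift f (λ x → f x + q * N) (q * N) (λ x → pf x q) o r) (sym (win-map (_+ q * N) f o r))

  win-Invariant : ∀ {α} → Invariant α → ∀ q o r → win α (o + q * N) r ≡ win α o r
  win-Invariant {α} iα q o r = win-shift α α (q * N) (λ x → iα x q) o r

  Cycle-+i : ∀ {α p} → Invariant α → Periodic p → ∀ {ys} o i → Cycle α p ys o →
    ∃ λ ys′ → Cycle α p ys′ (o + + i) × (ys , o) TransportsTo (ys′ , o + + i)
  Cycle-+i {α} {p} iα pp {ys} o zero cyc =
    ys , subst (Cycle α p ys) (sym (ℤP.+-identityʳ o)) cyc ,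
    λ q pq e → trans e (cong (λ z → win q z n) (sym (ℤP.+-identityʳ o)))
  Cycle-+i {α} {p} iα pp o (suc i) cyc =
    let ys₁ , cyc₁ , t₁ = Cycle-+1 iα pp o cyc
        ys₂ , cyc₂ , t₂ = Cycle-+i iα pp (o + 1ℤ) i cyc₁
    in ys₂ , subst (Cycle α p ys₂) (shift-1 o i) cyc₂ ,
       λ q pq e → trans (t₂ q pq (t₁ q pq e)) (cong (λ z → win q z n) (shift-1 o i))

  Cycle-+qN : ∀ {α p} → Invariant α → Periodic p → ∀ {ys} o k → Cycle α p ys o →
    ∃ λ ys′ → Cycle α p ys′ (o + k * N) × (ys , o) TransportsTo (ys′ , o + k * N)
  Cycle-+qN {α} {p} iα pp {ys} o k (c , r) = map (_+ k * N) ys ,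
    (c + k * N , subst₂ (λ bs xs → Run bs (c + k * N) xs (map (_+ k * N) ys) (c + k * N + N))
      (sym (win-Invariant iα k o n))
      (trans (sym (win-Periodic pp k (o + 1ℤ) n)) (cong (λ z → win p z n) (lem o 1ℤ (k * N))))
      (subst (Run _ _ _ _) (lem c N (k * N)) (Run-shift (k * N) r))) ,
    λ { q pq refl → sym (win-Periodic pq k o n) }
    where
    lem : ∀ a b c → a + b + c ≡ a + c + b
    lem = solve-∀

  split-offset : ∀ a b → a + + res (b - a) + _~_.quot (res-~ (b - a)) * N ≡ b
  split-offset a b = trans (ℤP.+-assoc a _ _) (trans (cong (_+_ a) (sym (_~_.eq (res-~ (b - a))))) (lem a b))
    where
    lem : ∀ a b → a + (b - a) ≡ b
    lem = solve-∀

  Cycle-move : ∀ {α p} → Invariant α → Periodic p → ∀ {ys} a b → Cycle α p ys a →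
    ∃ λ ys′ → Cycle α p ys′ b × (ys , a) TransportsTo (ys′ , b)
  Cycle-move {α} {p} iα pp {ys} a b cyc =
    let ys₁ , cyc₁ , t₁ = Cycle-+i iα pp a (res (b - a)) cyc
        ys₂ , cyc₂ , t₂ = Cycle-+qN iα pp (a + + res (b - a)) (_~_.quot (res-~ (b - a))) cyc₁
    in ys₂ , subst (Cycle α p ys₂) (split-offset a b) cyc₂ ,
       λ q pq e → trans (t₂ q pq (t₁ q pq e)) (cong (λ z → win q z n) (split-offset a b))

  count-+i : ∀ {α} → Invariant α → ∀ o i → count (win α (o + + i) n) ≡ count (win α o n)
  count-+i {α} iα o zero    = cong (λ z → count (win α z n)) (ℤP.+-identityʳ o)
  count-+i {α} iα o (suc i) = trans (cong (λ z → count (win α z n)) (sym (shift-1 o i)))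
    (trans (count-+i iα (o + 1ℤ) i)
    (trans (cong count (trans (win-rotate α o) (cong (win α (o + 1ℤ) (suc n-2) ∷ʳ_) (Invariant-+N iα o))))
      (count-∷ʳ (win α (o + 1ℤ) (suc n-2)) (α o))))

  count-move : ∀ {α} → Invariant α → ∀ a b → count (win α b n) ≡ count (win α a n)
  count-move {α} iα a b = trans (cong (λ z → count (win α z n)) (sym (split-offset a b)))
    (trans (cong count (win-Invariant iα (_~_.quot (res-~ (b - a))) (a + + res (b - a)) n)) (count-+i iα a (res (b - a))))

-- A cyclically decreasing product as one turn of a carrier

module Subsets (n-2 : ℕ) where
  open Affine n-2
  open Action n-2
  open Reduced

  module _ (A : List ℕ) where

    member : ℤ → Bool
    member x = memb (res x) A

    member-invariant : Invariant member
    member-invariant x q = cong (λ i → memb i A) (~⇒res (~-per x q))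

    actIf : Vect n → ℕ → Vect n
    actIf v i = if memb i A then uAct n i v else v

    act[] : ∀ is → foldl actIf [] is ≡ []
    act[] [] = refl
    act[] (i ∷ is) with memb i A
    ... | true  = act[] is
    ... | false = act[] is

    Untouched : ℤ → ℕ → ℤ → Set
    Untouched a r x = ∀ i → i ℕ.≤ r → ¬ x ~ a + + i

    -- `vanishes` must also exclude every run, or the transfer sum would count a killed product. The
    -- last field of `survives` keeps everything outside the segment fixed, so values already
    -- written stay final.
    data Outcome (t : Term n) (ws : List ℕ) (a : ℤ) (r : ℕ) (bs : List Bool) (v : Vect n) : Set where
      vanishes : v ≡ [] → (∀ ys e → ¬ Run bs (P ws a) (win (P ws) (a + 1ℤ) r) ys e) → Outcome t ws a r bs v
      survives : ∀ t′ ws′ → v ≡ t′ ∷ [] → Reduced t′ ws′ →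
                 Run bs (P ws a) (win (P ws) (a + 1ℤ) r) (win (P ws′) a r) (P ws′ (a + + r)) →
                 proj₂ t′ ≡ proj₂ t ℕ.+ count bs →
                 (∀ x → Untouched a r x → P ws′ x ≡ P ws x) →
                 Outcome t ws a r bs v

    -- The segment is shorter than a full turn, so its positions have distinct residues.
    Untouched-head : ∀ a r → suc r ℕ.< n → Untouched (a + 1ℤ) r a
    Untouched-head a r r<n i i≤r a~ with ~-offset a 0 (suc i) (ℕ.s≤s ℕ.z≤n) (ℕP.≤-<-trans (ℕ.s≤s i≤r) r<n)
      (~-trans (~-reflexive (ℤP.+-identityʳ a)) (subst (a ~_) (shift-1 a i) a~))
    ... | ()

    Untouched-tail : ∀ {a r x} → Untouched a (suc r) x → Untouched (a + 1ℤ) r x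
    Untouched-tail {a} u i i≤r x~ = u (suc i) (ℕ.s≤s i≤r) (subst (_ ~_) (shift-1 a i) x~)

    extend-cut : ∀ {t ws a r bs v} → suc r ℕ.< n → Outcome t ws (a + 1ℤ) r bs v →
      Outcome t ws a (suc r) (false ∷ bs) v
    extend-cut r<n (vanishes e none) = vanishes e λ { (_ ∷ ys) e (cut run) → none ys e run }
    extend-cut {t} {ws} {a} {r} {bs} r<n (survives t′ ws′ e red′ run len same) = survives t′ ws′ e red′
      (subst₂ (λ c e → Run (false ∷ bs) (P ws a) (win (P ws) (a + 1ℤ) (suc r)) (c ∷ win (P ws′) (a + 1ℤ) r) e)
        (sym (same a (Untouched-head a r r<n))) (cong (P ws′) (shift-1 a r)) (cut run))
      len (λ x u → same x (Untouched-tail {a} u))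

    P-∷-miss : ∀ ws a x → ¬ x ~ a → ¬ x ~ a + 1ℤ → P (res a ∷ ws) x ≡ P ws x
    P-∷-miss ws a x ¬p ¬q = cong (P ws) (s-miss (res a) x
      (λ h → ¬p (~-trans h (~-sym (res-~ a)))) (λ h → ¬q (~-trans h (~-sym (~-+ 1ℤ (res-~ a))))))

    P-∷-ahead : ∀ ws a r → suc r ℕ.< n → win (P (res a ∷ ws)) (a + 1ℤ + 1ℤ) r ≡ win (P ws) (a + 1ℤ + 1ℤ) r
    P-∷-ahead ws a r r<n = win-cong (a + 1ℤ + 1ℤ) r λ i i<r → subst (λ x → P (res a ∷ ws) x ≡ P ws x)
      (sym (trans (shift-1 (a + 1ℤ) i) (shift-1 a (suc i))))
      (P-∷-miss ws a (a + + suc (suc i))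
        (λ h → ℕP.1+n≢0 (~-offset a (suc (suc i)) 0 (ℕP.≤-<-trans (ℕ.s≤s i<r) r<n) (ℕ.s≤s ℕ.z≤n)
          (~-trans h (~-reflexive (sym (ℤP.+-identityʳ a))))))
        (λ h → ℕP.1+n≢0 (ℕP.suc-injective (~-offset a (suc (suc i)) 1 (ℕP.≤-<-trans (ℕ.s≤s i<r) r<n) (ℕ.s≤s (ℕ.s≤s ℕ.z≤n)) h))))

    extend-pass : ∀ {t t₁ ws a r bs v} → suc r ℕ.< n → Ascent ws a → proj₂ t₁ ≡ suc (proj₂ t) →
      Outcome t₁ (res a ∷ ws) (a + 1ℤ) r bs v → Outcome t ws a (suc r) (true ∷ bs) v
    extend-pass {ws = ws} {a} {r} {bs} r<n asc len₁ (vanishes e none) = vanishes e λ { (_ ∷ ys) e (pass _ run) →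
      none ys e (subst₂ (λ c xs → Run bs c xs ys e) (sym (P-∷-down (res a) ws (res-~ a))) (sym (P-∷-ahead ws a r r<n)) run) }
    extend-pass {t} {ws = ws} {a} {r} {bs} r<n asc len₁ (survives t′ ws′ e red′ run len same) = survives t′ ws′ e red′
      (subst₂ (λ y e → Run (true ∷ bs) (P ws a) (win (P ws) (a + 1ℤ) (suc r)) (y ∷ win (P ws′) (a + 1ℤ) r) e)
        (sym (trans (same a (Untouched-head a r r<n)) (P-∷-up (res a) ws (res-~ a)))) (cong (P ws′) (shift-1 a r))
        (pass asc (subst₂ (λ c xs → Run bs c xs (win (P ws′) (a + 1ℤ) r) (P ws′ (a + 1ℤ + + r)))
          (P-∷-down (res a) ws (res-~ a)) (P-∷-ahead ws a r r<n) run)))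
      (trans len (trans (cong (ℕ._+ count bs) len₁) (sym (ℕP.+-suc (proj₂ t) (count bs)))))
      (λ x u → trans (same x (Untouched-tail {a} u)) (P-∷-miss ws a x
        (λ h → u 0 ℕ.z≤n (~-trans h (~-reflexive (sym (ℤP.+-identityʳ a)))))
        (λ h → u 1 (ℕ.s≤s ℕ.z≤n) h)))

    -- The hand is the value currently at position `a`. Applying u_a pushes it on to `a + 1`, a pass
    -- allowed exactly at an ascent; omitting u_a leaves it at `a` and takes up the next value, a
    -- drop.
    outcome : ∀ r a {t ws} → Reduced t ws → r ℕ.< n → Outcome t ws a r (win member a r) (foldl actIf (t ∷ []) (win res a r))
    outcome-suc : ∀ r a {t ws} → Reduced t ws → suc r ℕ.< n → ∀ b → Outcome t ws a (suc r) (b ∷ win member (a + 1ℤ) r)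
      (foldl actIf (if b then uAct n (res a) (t ∷ []) else t ∷ []) (win res (a + 1ℤ) r))

    outcome zero a {t} {ws} red r<n = survives t ws refl red
      (subst (Run [] (P ws a) [] []) (cong (P ws) (sym (ℤP.+-identityʳ a))) stop) (sym (ℕP.+-identityʳ _)) (λ _ _ → refl)
    outcome (suc r) a red r<n = outcome-suc r a red r<n (memb (res a) A)

    outcome-suc r a red r<n false = extend-cut r<n (outcome r (a + 1ℤ) red (ℕP.<-trans (ℕP.n<1+n r) r<n))
    outcome-suc r a {t} {ws} red r<n true = case (ascent⊎descent ws a)
      where
      goal : Vect n → Set
      goal v = Outcome t ws a (suc r) (true ∷ win member (a + 1ℤ) r) (foldl actIf (v ++ []) (win res (a + 1ℤ) r))
      case : Ascent ws a ⊎ Descent ws a → goal (uTerm n (res a) t)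
      case (inj₂ desc) = subst goal (sym (uTerm-descent (res a) red (res<n a) (res-~ a) desc))
        (vanishes (act[] (win res (a + 1ℤ) r)) λ { (_ ∷ ys) e (pass asc _) → ℤP.<-asym asc desc })
      case (inj₁ asc) = subst goal (sym (proj₁ acts)) (extend-pass r<n asc refl
        (outcome r (a + 1ℤ) (proj₂ acts) (ℕP.<-trans (ℕP.n<1+n r) r<n)))
        where acts = uTerm-ascent (res a) red (res<n a) (res-~ a) asc

    data SubsetOutcome (t : Term n) (ws : List ℕ) (v : Vect n) : Set where
      vanishes : v ≡ [] → (∀ o ys → ¬ Cycle member (P ws) ys o) → SubsetOutcome t ws v
      survives : ∀ t′ ws′ → v ≡ t′ ∷ [] → Reduced t′ ws′ → (∀ o → Cycle member (P ws) (win (P ws′) o n) o) →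
                 proj₂ t′ ≡ proj₂ t ℕ.+ count (win member 0ℤ n) → SubsetOutcome t ws v

    uSubset-foldl : ∀ v {j} → firstOut n A ≡ just j → uSubset n A v ≡ foldl actIf v (win res (+ j + 1ℤ) (suc n-2))
    uSubset-foldl v {j} e = trans (cong (foldl (λ v m → uAct n m v) v) (order e))
      (trans (foldl-filter (λ m → memb m A Bool.≟ true) (λ v m → uAct n m v) v (map pos (upTo (suc n-2))))
      (trans (foldl-cong {g = actIf} (λ v m → cong (λ b → if b then uAct n m v else v) (does-≟-true (memb m A)))
               v (map pos (upTo (suc n-2))))
        (cong (foldl actIf v) (trans (ListP.map-upTo pos (suc n-2))
          (trans (applyUpTo-cong (suc n-2) (λ i _ → cong (modℕ n) (sym (ℕP.+-assoc j 1 i))))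
            (sym (win-applyUpTo res (+ j + 1ℤ) (suc n-2))))))))
      where
      pos : ℕ → ℕ
      pos i = modℕ n (j ℕ.+ suc i)
      order : firstOut n A ≡ just j → applyOrder n A ≡
        filter (λ m → memb m A Bool.≟ true) (map pos (upTo (suc n-2)))
      order e with firstOut n A
      order refl | just _ = refl
      does-≟-true : ∀ b → does (b Bool.≟ true) ≡ b
      does-≟-true true  = refl
      does-≟-true false = refl

    -- Cut the circle at some j outside `A`, where the carrier must drop. It starts with the new
    -- value at j, and periodicity of the new sequence shows that it returns with that value plus
    -- `N`. `Cycle-move` then removes the dependence on j.
    subsetOutcome : ∀ {t ws} i → i ℕ.< n → memb i A ≡ false → Reduced t ws → SubsetOutcome t ws (uSubset n A (t ∷ []))
    subsetOutcome {t} {ws} i i<n i∉A red =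
      subst (SubsetOutcome t ws) (sym (uSubset-foldl (t ∷ []) e)) (close (outcome (suc n-2) (+ j + 1ℤ) red (ℕP.n<1+n _)))
      where
      first = firstOut-just n A i<n i∉A
      j = proj₁ first
      e = proj₁ (proj₂ first)
      j∉ : member (+ j) ≡ false
      j∉ = trans (cong (λ i → memb i A) (res-small (proj₁ (proj₂ (proj₂ first))))) (proj₂ (proj₂ (proj₂ first)))
      around : + j + 1ℤ + + suc n-2 ≡ + j + N
      around = shift-1 (+ j) (suc n-2)
      bs = win member (+ j + 1ℤ) (suc n-2)
      xs = win (P ws) (+ j + 1ℤ + 1ℤ) (suc n-2)
      uncut : ∀ {b c ys d} → b ≡ false → Run (b ∷ bs) c (P ws (+ j + 1ℤ) ∷ xs) ys d →
        ∃ λ zs → Run bs (P ws (+ j + 1ℤ)) xs zs d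
      uncut refl (cut r) = _ , r
      close : ∀ {v} → Outcome t ws (+ j + 1ℤ) (suc n-2) bs v → SubsetOutcome t ws v
      close (vanishes v≡ none) = vanishes v≡ λ o ys cyc →
        let _ , (c , r) , _ = Cycle-move member-invariant (P-periodic ws) o (+ j) cyc
            zs , r′ = uncut j∉ r
        in none zs (c + N) r′
      close (survives t′ ws′ v≡ red′ run len _) = survives t′ ws′ v≡ red′ at
        (trans len (cong (proj₂ t ℕ.+_) (trans (cong (λ b → count (b ∷ bs)) (sym j∉)) (count-move member-invariant 0ℤ (+ j)))))
        where
        at-j : Cycle member (P ws) (win (P ws′) (+ j) n) (+ j)
        at-j = P ws′ (+ j) , subst₂ (λ b d → Run (b ∷ bs) (P ws′ (+ j)) (P ws (+ j + 1ℤ) ∷ xs) (win (P ws′) (+ j) n) d)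
          (sym j∉) (trans (cong (P ws′) around) (Periodic-+N {P ws′} (P-periodic ws′) (+ j))) (cut run)
        at : ∀ o → Cycle member (P ws) (win (P ws′) o n) o
        at o = let ys′ , cyc , transport = Cycle-move member-invariant (P-periodic ws) (+ j) o at-j
          in subst (λ ys → Cycle member (P ws) ys o) (transport (P ws′) (P-periodic ws′) refl) cyc

-- Commutation of h_k and h_l

uSubset-concatMap : ∀ n A v → uSubset n A v ≡ concatMap (λ t → uSubset n A (t ∷ [])) v
uSubset-concatMap n A v = go (applyOrder n A) v
  where
  act : List ℕ → Vect n → Vect n
  act is v = foldl (λ v i → uAct n i v) v is
  act₁ : List ℕ → Term n → Vect n
  act₁ is t = act is (t ∷ [])
  go : ∀ is v → act is v ≡ concatMap (act₁ is) v
  go []       v = sym (ListP.concatMap-pure v)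
  go (i ∷ is) v = trans (go is (uAct n i v)) (trans (collapse v)
    (ListP.concatMap-cong (λ t → sym (trans (cong (act is) (ListP.++-identityʳ (uTerm n i t))) (go is (uTerm n i t)))) v))
    where
    collapse : ∀ v → concatMap (act₁ is) (concatMap (uTerm n i) v) ≡ concatMap (concatMap (act₁ is) ∘ uTerm n i) v
    collapse []      = refl
    collapse (t ∷ v) = trans (ListP.concatMap-++ (act₁ is) (uTerm n i t) (concatMap (uTerm n i) v))
      (cong (concatMap (act₁ is) (uTerm n i t) ++_) (collapse v))

module Commutation (n-2 : ℕ) where
  open Affine n-2
  open Action n-2
  open Subsets n-2
  open Reduced

  -- The transpose of h_K on functions of terms; in `dual K (dual L ψ)` it is h_K that acts first.
  dual : ℕ → (Term n → ℤ) → Term n → ℤ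
  dual K ψ t = Σ[ A ← choose K (upTo n) ] Σl (uSubset n A (t ∷ [])) ψ

  hAct-dual : ∀ K v (ψ : Term n → ℤ) → Σl (hAct n K v) ψ ≡ Σl v (dual K ψ)
  hAct-dual K v ψ = trans (Σl-concatMap (λ A → uSubset n A v) (choose K (upTo n)) ψ)
    (trans (Σl-cong (choose K (upTo n)) (λ A _ → trans (cong (λ u → Σl u ψ) (uSubset-concatMap n A v))
      (Σl-concatMap (λ t → uSubset n A (t ∷ [])) v ψ)))
      (Σl-swap (choose K (upTo n)) v (λ A t → Σl (uSubset n A (t ∷ [])) ψ)))

  subset : List Bool → List ℕ
  subset bs = select bs (upTo n)

  member-subset : ∀ bs → length bs ≡ n → win (member (subset bs)) 0ℤ n ≡ bs
  member-subset bs l = trans (win-applyUpTo (member (subset bs)) 0ℤ n)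
    (trans (applyUpTo-cong n (λ i i<n → cong (λ i → memb i (subset bs)) (res-small i<n)))
      (subst (λ r → applyUpTo (λ i → memb i (select bs (applyUpTo id r))) r ≡ bs) l (memb-select id (λ _ _ e → e) bs)))

  missing : ∀ bs → length bs ≡ n → false ∈ bs → ∃ λ i → i ℕ.< n × memb i (subset bs) ≡ false
  missing bs l f∈ = let x , e = win-∈ (member (subset bs)) 0ℤ n (subst (false ∈_) (sym (member-subset bs l)) f∈)
    in res x , res<n x , sym e

  N≢0 : N ≢ 0ℤ
  N≢0 ()

  c+N-N : ∀ c → c + N - N ≡ c
  c+N-N c = lem c N
    where
    lem : ∀ c N → c + N - N ≡ c
    lem = solve-∀

  -- ρ turns the bits b₀ ⋯ bₙ₋₁ of a subset into the cyclic word b_o ⋯ b_{o+n-1}.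
  record Reading (o : ℤ) : Set where
    field
      ρ         : List Bool → List Bool
      reads     : ∀ bs → length bs ≡ n → win (member (subset bs)) o n ≡ ρ bs
      Σ-reading : ∀ (F : List Bool → ℤ) → Σl (bitStrings n) (F ∘ ρ) ≡ Σl (bitStrings n) F

  open Reading

  reading₀ : Reading 0ℤ
  reading₀ = record { ρ = id ; reads = member-subset ; Σ-reading = λ F → refl }

  reading₁ : Reading 1ℤ
  reading₁ = record { ρ = rotate ; reads = reads₁ ; Σ-reading = Σ-rotate n }
    where
    reads₁ : ∀ bs → length bs ≡ n → win (member (subset bs)) 1ℤ n ≡ rotate bs
    reads₁ bs l = trans (win-rotate α 0ℤ)
      (trans (cong (win α 1ℤ (suc n-2) ∷ʳ_) (Invariant-+N {α} (member-invariant (subset bs)) 0ℤ))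
        (cong rotate (member-subset bs l)))
      where
      α = member (subset bs)

  module _ {o : ℤ} (rd : Reading o) {t : Term n} {ws : List ℕ} (red : Reduced t ws)
           (S : List ℤ) (unique : Unique S) (hands : ∀ {z} → z ∈ win (P ws) (o + 1ℤ) n → z - N ∈ S)
           (ψ : Term n → ℤ) (φ : List ℤ → ℤ)
           (compatible : ∀ {α t′ ws′} → Reduced t′ ws′ → Cycle α (P ws) (win (P ws′) o n) o → ψ t′ ≡ φ (win (P ws′) o n))
           where

    X : List ℤ
    X = win (P ws) (o + 1ℤ) n

    start∈S : ∀ {bs c ys} → Run bs c X ys (c + N) → c ∈ S
    start∈S {c = c} r = subst (_∈ S) (c+N-N c) (hands (closed-end N≢0 r))

    subset-runTrace : ∀ K → K ℕ.< n → ∀ bs → length bs ≡ n →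
      [ does (count bs ℕ.≟ K) ]· Σl (uSubset n (subset bs) (t ∷ [])) ψ ≡ runTrace N S K φ X (ρ rd bs)
    subset-runTrace K K<n bs l = by-count (count bs ℕ.≟ K)
      where
      α = member (subset bs)
      count-ρ : count (ρ rd bs) ≡ count bs
      count-ρ = trans (cong count (sym (reads rd bs l))) (trans (count-move (member-invariant (subset bs)) 0ℤ o)
        (cong count (member-subset bs l)))
      by-outcome : count bs ≡ K → ∀ {v} → SubsetOutcome (subset bs) t ws v → Σl v ψ ≡ runTrace N S K φ X (ρ rd bs)
      by-outcome c (vanishes refl none) = sym (runTrace-none N S K φ X (ρ rd bs)
        λ d ys r → none o ys (d , subst (λ b → Run b d X ys (d + N)) (sym (reads rd bs l)) r))
      by-outcome c (survives t′ ws′ refl red′ cyc _) = trans (ℤP.+-identityʳ (ψ t′)) (trans (compatible red′ (cyc o))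
        (sym (trans (runTrace-Run N S N≢0 K φ X (ρ rd bs) unique (start∈S (proj₂ (cyc o)))
               (subst (λ b → Run b _ X (win (P ws′) o n) _) (reads rd bs l) (proj₂ (cyc o))))
             (cong ([_]· φ (win (P ws′) o n)) (≡ᵇ-true (trans count-ρ c))))))
      by-count : Dec (count bs ≡ K) → [ does (count bs ℕ.≟ K) ]· Σl (uSubset n (subset bs) (t ∷ [])) ψ ≡ runTrace N S K φ X (ρ rd bs)
      by-count (no c≢K) = trans (cong ([_]· Σl (uSubset n (subset bs) (t ∷ [])) ψ) (≡ᵇ-false c≢K))
        (sym (runTrace-count N S K φ X (ρ rd bs) (c≢K ∘ trans (sym count-ρ))))
      by-count (yes c) = trans (cong ([_]· Σl (uSubset n (subset bs) (t ∷ [])) ψ) (≡ᵇ-true c))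
        -- As `K` is less than `n`, some bit is false: the subset is proper, and the circle can be
        -- cut.
        (let i , i<n , i∉ = missing bs l (count<⇒false∈ bs (subst₂ ℕ._<_ (sym c) (sym l) K<n))
         in by-outcome c (subsetOutcome (subset bs) i i<n i∉ red))

    -- The two sums agree subset by subset. `compatible` asks about `ψ` only at terms produced by a
    -- run, so when `ψ` is itself a `dual`, the outer run can supply what the inner application
    -- needs.
    dual-transfer : ∀ K → K ℕ.< n → dual K ψ t ≡ Trace.transfer N S K φ X
    dual-transfer K K<n = trans (Σ-choose K (upTo n) (λ A → Σl (uSubset n A (t ∷ [])) ψ))
      (trans (cong (λ r → Σ[ bs ← bitStrings r ] [ does (count bs ℕ.≟ K) ]· Σl (uSubset n (subset bs) (t ∷ [])) ψ) (ListP.length-upTo n))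
      (trans (Σl-cong (bitStrings n) (λ bs bs∈ → subset-runTrace K K<n bs (bitStrings-length n bs∈)))
      (trans (Σ-reading rd (runTrace N S K φ X))
      (trans (cong (λ r → Σl (bitStrings r) (runTrace N S K φ X)) (sym (win-length (P ws) (o + 1ℤ) n)))
        (sym (transfer-bitStrings N S K φ X))))))

  δ : Term n → Term n → ℤ
  δ t₀ t = [ does (VecP.≡-dec ℤ._≟_ (proj₁ t) (proj₁ t₀)) ]· 1ℤ

  -- A periodic sequence is determined by any of its windows, and p determines w, so a function of
  -- the carrier's output can recognise the group element.
  δ-win : ∀ {t₀ t vs ws} → Reduced t₀ vs → Reduced t ws →
    δ t₀ t ≡ [ does (ListP.≡-dec ℤ._≟_ (win (P ws) 0ℤ n) (win (P vs) 0ℤ n)) ]· 1ℤ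
  δ-win {t₀} {t} {vs} {ws} red₀ red = cong ([_]· 1ℤ) (does-⇔ (mk⇔
    (λ e → win-cong 0ℤ n λ i _ →
      evalWord⇒P ws vs (trans (evaluates red) (trans e (sym (evaluates red₀)))) (0ℤ + + i))
    (λ e → trans (sym (evaluates red)) (trans
      (P⇒evalWord ws vs (periodic-agree (P-periodic ws) (P-periodic vs) 0ℤ (win-≡ (P ws) (P vs) 0ℤ n e))) (evaluates red₀))))
    (VecP.≡-dec ℤ._≟_ (proj₁ t) (proj₁ t₀)) (ListP.≡-dec ℤ._≟_ (win (P ws) 0ℤ n) (win (P vs) 0ℤ n)))

  module _ {t₀ : Term n} {vs : List ℕ} (red₀ : Reduced t₀ vs) {t : Term n} {ws : List ℕ} (red : Reduced t ws) where

    private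
      Y : List ℤ
      Y = win (P ws) (1ℤ + 1ℤ) n

      -- The first hand c has `c + N` in `Y`. The second carrier reads values from `Y` together with
      -- c, so its hand lies in `Y` minus `N` or, when it closes up on c, in `Y` minus twice `N`.
      S₀ S : List ℤ
      S₀ = map (_- N) Y ++ map (λ z → z - N - N) Y
      S  = deduplicate ℤ._≟_ S₀

      φ : List ℤ → ℤ
      φ zs = [ does (ListP.≡-dec ℤ._≟_ zs (win (P vs) 0ℤ n)) ]· 1ℤ

      ∈S : ∀ {z} → z ∈ S₀ → z ∈ S
      ∈S = ∈P.∈-deduplicate⁺ ℤ._≟_

      hands₁ : ∀ {z} → z ∈ Y → z - N ∈ S
      hands₁ z∈ = ∈S (∈P.∈-++⁺ˡ (∈P.∈-map⁺ (_- N) z∈))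

      hands₀ : ∀ {α ws′} → Cycle α (P ws) (win (P ws′) 1ℤ n) 1ℤ → ∀ {z} → z ∈ win (P ws′) (0ℤ + 1ℤ) n → z - N ∈ S
      hands₀ (c , r) z∈ with Run-outputs r z∈
      ... | there z∈Y = hands₁ z∈Y
      ... | here refl = ∈S (∈P.∈-++⁺ʳ (map (_- N) Y)
        (subst (λ z → z - N ∈ map (λ z → z - N - N) Y) (c+N-N c)
          (∈P.∈-map⁺ (λ z → z - N - N) (closed-end N≢0 r))))

    dual-dual : ∀ K L → K ℕ.< n → L ℕ.< n → dual K (dual L (δ t₀)) t ≡ Trace.transfer N S K (Trace.transfer N S L φ) Y
    dual-dual K L K<n L<n = dual-transfer reading₁ red S (UniqueP.deduplicate-! ℤ._≟_ S₀) hands₁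
      (dual L (δ t₀)) (Trace.transfer N S L φ)
      (λ {α} {t′} {ws′} red′ cyc → dual-transfer reading₀ red′ S (UniqueP.deduplicate-! ℤ._≟_ S₀) (hands₀ {α} {ws′} cyc) (δ t₀) φ
        (λ red″ _ → δ-win red₀ red″) L L<n)
      K K<n

    dual-comm : ∀ K L → K ℕ.< n → L ℕ.< n → dual K (dual L (δ t₀)) t ≡ dual L (dual K (δ t₀)) t
    dual-comm K L K<n L<n = trans (dual-dual K L K<n L<n)
      (trans (Trace.transfer-comm N S φ K L Y) (sym (dual-dual L K L<n K<n)))

-- Symmetry and the expansion into monomial symmetric functions

Σl-↭ : ∀ {A : Set} {V V′ : List A} (f : A → ℤ) → V ↭ V′ → Σl V f ≡ Σl V′ f
Σl-↭ f Perm.refl         = refl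
Σl-↭ f (prep x p)        = cong (_+_ (f x)) (Σl-↭ f p)
Σl-↭ {V′ = _ ∷ _ ∷ ys} f (swap x y p) = trans (cong (λ z → f x + (f y + z)) (Σl-↭ f p)) (lem (f x) (f y) (Σl ys f))
  where
  lem : ∀ a b c → a + (b + c) ≡ b + (a + c)
  lem = solve-∀
Σl-↭ f (Perm.trans p q) = trans (Σl-↭ f p) (Σl-↭ f q)

module _ {A : Set} (Q : A → Set) (δ : A → A → ℤ) (δ-refl : ∀ x → δ x x ≡ 1ℤ) (δ-nonneg : ∀ x y → 0ℤ ≤ δ x y)
         (δ-separates : ∀ {x y} → Q x → Q y → δ x y ≢ 0ℤ → x ≡ y) where

  δ-sum-∈ : ∀ {x} V → Q x → All Q V → Σl V (δ x) ≢ 0ℤ → x ∈ V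
  δ-sum-∈ []      qx qV ≢0 = ⊥-elim (≢0 refl)
  δ-sum-∈ {x} (y ∷ V) qx (qy ∷ qV) ≢0 with δ x y ≟ 0ℤ
  ... | no δ≢0 = here (δ-separates qx qy δ≢0)
  ... | yes δ≡0 = there (δ-sum-∈ V qx qV λ e → ≢0 (cong₂ _+_ δ≡0 e))

  δ-sum-∷ : ∀ x V → Σl (x ∷ V) (δ x) ≢ 0ℤ
  δ-sum-∷ x V e = ℤP.<-irrefl (sym e) (ℤP.<-≤-trans (ℤ.+<+ (ℕ.s≤s ℕ.z≤n))
    (subst (_≤ Σl (x ∷ V) (δ x)) (trans (ℤP.+-identityʳ (δ x x)) (δ-refl x)) (ℤP.+-monoʳ-≤ (δ x x) (nonneg V))))
    where
    nonneg : ∀ V → 0ℤ ≤ Σl V (δ x)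
    nonneg []      = ℤP.≤-refl
    nonneg (y ∷ V) = ℤP.+-mono-≤ (δ-nonneg x y) (nonneg V)

  -- The sum of `δ x` is the multiplicity of x. The head of one list therefore occurs in the other;
  -- remove both copies and recurse.
  equal-sums⇒↭ : ∀ V V′ → All Q V → All Q V′ → (∀ x → Q x → Σl V (δ x) ≡ Σl V′ (δ x)) → V ↭ V′
  equal-sums⇒↭ []      []      _ _ _ = Perm.refl
  equal-sums⇒↭ []      (x ∷ V′) _ (qx ∷ _) e = ⊥-elim (δ-sum-∷ x V′ (sym (e x qx)))
  equal-sums⇒↭ (x ∷ V) V′ (qx ∷ qV) qV′ e
    with xs , ys , refl ← ∈P.∈-∃++ (δ-sum-∈ V′ qx qV′ (λ e₀ → δ-sum-∷ x V (trans (e x qx) e₀)))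
    with qx′ ∷ q ← PermP.All-resp-↭ (PermP.shift x xs ys) qV′ =
    ↭-trans (prep x (equal-sums⇒↭ V (xs ++ ys) qV q λ y qy →
      ∙-cancelˡ (δ y x) _ _ (trans (e y qy) (Σl-↭ (δ y) (PermP.shift x xs ys)))))
      (↭-sym (PermP.shift x xs ys))

module Symmetry (n-2 : ℕ) where
  open Affine n-2
  open Action n-2
  open Subsets n-2
  open Commutation n-2
  open Reduced

  ReducedOf : ℕ → Term n → Set
  ReducedOf m t = ∃ (Reduced t) × proj₂ t ≡ m

  -- The tags agree as soon as the windows do, both being the least length of a word for the same
  -- element.
  δ-separates : ∀ {t₀ t} → ∃ (Reduced t₀) → ∃ (Reduced t) → δ t₀ t ≢ 0ℤ → t₀ ≡ t
  δ-separates {t₀} {t} (vs , red₀) (ws , red) ≢0 with VecP.≡-dec ℤ._≟_ (proj₁ t) (proj₁ t₀)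
  ... | no _  = ⊥-elim (≢0 refl)
  ... | yes e = cong₂ _,_ (sym e) (ℕP.≤-antisym
    (subst (proj₂ t₀ ℕ.≤_) (length≡ red) (shortest red₀ ws (letters red) (trans (evaluates red) e)))
    (subst (proj₂ t ℕ.≤_) (length≡ red₀) (shortest red vs (letters red₀) (trans (evaluates red₀) (sym e)))))

  δ-refl : ∀ t → δ t t ≡ 1ℤ
  δ-refl t with VecP.≡-dec ℤ._≟_ (proj₁ t) (proj₁ t)
  ... | yes _ = refl
  ... | no ne = ⊥-elim (ne refl)

  δ-nonneg : ∀ t₀ t → 0ℤ ≤ δ t₀ t
  δ-nonneg t₀ t with does (VecP.≡-dec ℤ._≟_ (proj₁ t) (proj₁ t₀))
  ... | true  = ℤ.+≤+ ℕ.z≤n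
  ... | false = ℤ.+≤+ ℕ.z≤n

  hAct-reduced : ∀ {K m v} → K ℕ.< n → All (ReducedOf m) v → All (ReducedOf (m ℕ.+ K)) (hAct n K v)
  hAct-reduced {K} {m} {v} K<n reds = All.tabulate λ t∈ →
    let A , A∈ , t∈A = find (∈P.∈-concatMap⁻ (λ A → uSubset n A v) {xs = choose K (upTo n)} t∈)
        t₁ , t₁∈ , t∈₁ = find (∈P.∈-concatMap⁻ (λ t → uSubset n A (t ∷ [])) {xs = v} (subst (_ ∈_) (uSubset-concatMap n A v) t∈A))
        (ws , red) , len = All.lookup reds t₁∈
        bs , l , c , A≡ = choose-select K (upTo n) A∈
        l′ = trans l (ListP.length-upTo n)
        i , i<n , i∉ = missing bs l′ (count<⇒false∈ bs (subst₂ ℕ._<_ (sym c) (sym l′) K<n))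
    in from bs l′ c len (subsetOutcome (subset bs) i i<n i∉ red) (subst (λ A → _ ∈ uSubset n A (t₁ ∷ [])) A≡ t∈₁)
    where
    from : ∀ bs → length bs ≡ n → count bs ≡ K → ∀ {t₁ ws u t} → proj₂ t₁ ≡ m → SubsetOutcome (subset bs) t₁ ws u → t ∈ u →
      ReducedOf (m ℕ.+ K) t
    from bs l c refl (vanishes refl _) ()
    from bs l c refl (survives t′ ws′ refl red′ _ len) (here refl) =
      (ws′ , red′) , trans len (cong (ℕ._+_ _) (trans (cong count (member-subset bs l)) c))

  -- `dual-comm` settles indicator functions only. These determine the multiset of terms, and
  -- permuted lists give equal sums for every `ψ`.
  dual-comm-all : ∀ {K L m t} ψ → K ℕ.< n → L ℕ.< n → ReducedOf m t → dual K (dual L ψ) t ≡ dual L (dual K ψ) t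
  dual-comm-all {K} {L} {m} {t} ψ K<n L<n good@((ws , red) , _) = trans (sym (expand K L ψ)) (trans
    (Σl-↭ ψ (equal-sums⇒↭ (λ t → ∃ (Reduced t)) δ δ-refl δ-nonneg δ-separates _ _ (reds K L K<n L<n) (reds L K L<n K<n)
      λ { t₀ (vs , red₀) → trans (expand K L (δ t₀)) (trans (dual-comm red₀ red K L K<n L<n) (sym (expand L K (δ t₀)))) }))
    (expand L K ψ))
    where
    expand : ∀ K L ψ → Σl (hAct n L (hAct n K (t ∷ []))) ψ ≡ dual K (dual L ψ) t
    expand K L ψ = trans (hAct-dual L (hAct n K (t ∷ [])) ψ) (trans (hAct-dual K (t ∷ []) (dual L ψ)) (ℤP.+-identityʳ _))
    reds : ∀ K L → K ℕ.< n → L ℕ.< n → All (λ t → ∃ (Reduced t)) (hAct n L (hAct n K (t ∷ [])))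
    reds K L K<n L<n = All.map proj₁ (hAct-reduced L<n (hAct-reduced K<n (good ∷ [])))

  hActs : Vect n → List ℕ → Vect n
  hActs = foldl (λ v k → hAct n k v)

  duals : List ℕ → (Term n → ℤ) → Term n → ℤ
  duals []      ψ = ψ
  duals (k ∷ a) ψ = dual k (duals a ψ)

  hActs-duals : ∀ a v ψ → Σl (hActs v a) ψ ≡ Σl v (duals a ψ)
  hActs-duals []      v ψ = refl
  hActs-duals (k ∷ a) v ψ = trans (hActs-duals a (hAct n k v) ψ) (hAct-dual k v (duals a ψ))

  hActs-reduced : ∀ {a m v} → All (ℕ._< n) a → All (ReducedOf m) v → All (ReducedOf (m ℕ.+ sum a)) (hActs v a)
  hActs-reduced {[]} {m} [] reds = subst (λ l → All (ReducedOf l) _) (sym (ℕP.+-identityʳ m)) reds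
  hActs-reduced {k ∷ a} {m} {v} (k<n ∷ a<n) reds =
    subst (λ l → All (ReducedOf l) (hActs (hAct n k v) a)) (ℕP.+-assoc m k (sum a)) (hActs-reduced a<n (hAct-reduced k<n reds))

  hActs-↭ : ∀ {a b m v} ψ → a ↭ b → All (ℕ._< n) a → All (ReducedOf m) v → Σl (hActs v a) ψ ≡ Σl (hActs v b) ψ
  hActs-↭ ψ Perm.refl a<n reds = refl
  hActs-↭ ψ (prep k p) (k<n ∷ a<n) reds = hActs-↭ ψ p a<n (hAct-reduced k<n reds)
  hActs-↭ {b = _ ∷ _ ∷ b} {v = v} ψ (swap k l p) (k<n ∷ l<n ∷ a<n) reds =
    trans (hActs-↭ ψ p a<n (hAct-reduced l<n (hAct-reduced k<n reds)))
    -- The factors after the swapped pair are transposed onto `ψ`, which is why commutation is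
    -- needed for arbitrary functions.
    (trans (hActs-duals (k ∷ l ∷ b) v ψ)
    (trans (Σl-cong v (λ t t∈ → dual-comm-all (duals b ψ) k<n l<n (All.lookup reds t∈)))
      (sym (hActs-duals (l ∷ k ∷ b) v ψ))))
  hActs-↭ ψ (Perm.trans p q) a<n reds =
    trans (hActs-↭ ψ p a<n reds) (hActs-↭ ψ q (PermP.All-resp-↭ p a<n) reds)

  one : Vect n
  one = (idW n , 0) ∷ []

  one-reduced : All (ReducedOf 0) one
  one-reduced = (([] , record { evaluates = refl ; letters = [] ; length≡ = refl ; shortest = λ _ _ _ → ℕ.z≤n }) , refl) ∷ []

  all<? : ∀ a → Dec (All (ℕ._< n) a)
  all<? = All.all? (ℕ._<? n)

  -- `δ` compares windows; the 0 is a default tag.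
  pairing-Σ : ∀ v w → + pairing v w ≡ Σl v (δ (w , 0))
  pairing-Σ []      w = refl
  pairing-Σ (t ∷ v) w with does (VecP.≡-dec ℤ._≟_ (proj₁ t) w)
  ... | true  = trans (ℤP.pos-+ 1 (pairing v w)) (cong (_+_ 1ℤ) (pairing-Σ v w))
  ... | false = trans (pairing-Σ v w) (sym (ℤP.+-identityˡ _))

  pairing-∈ : ∀ (v : Vect n) w → pairing v w ≢ 0 → ∃ λ t → t ∈ v × proj₁ t ≡ w
  pairing-∈ []      w ≢0 = ⊥-elim (≢0 refl)
  pairing-∈ (t ∷ v) w ≢0 with VecP.≡-dec ℤ._≟_ (proj₁ t) w
  ... | yes e = t , here refl , e
  ... | no _  = let t′ , t∈ , e = pairing-∈ v w ≢0 in t′ , there t∈ , e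

  module _ (w : Window n) where

    F : List ℕ → ℕ
    F = affStanleyCoeff n w

    any-≤ᵇ : ∀ a → All (ℕ._< n) a → any (λ k → n ℕ.≤ᵇ k) a ≡ false
    any-≤ᵇ []      []          = refl
    any-≤ᵇ (k ∷ a) (k<n ∷ a<n) with n ℕ.≤ᵇ k in e
    ... | true  = ⊥-elim (ℕP.<⇒≱ k<n (ℕP.≤ᵇ⇒≤ n k (subst T (sym e) _)))
    ... | false = any-≤ᵇ a a<n

    F-small : ∀ a → All (ℕ._< n) a → F a ≡ pairing (hActs one a) w
    F-small a a<n = cong (if_then 0 else pairing (hActs one a) w) (any-≤ᵇ a a<n)

    F-large : ∀ a → ¬ All (ℕ._< n) a → F a ≡ 0
    F-large a ¬a<n = cong (if_then 0 else pairing (hActs one a) w) (large a ¬a<n)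
      where
      large : ∀ a → ¬ All (ℕ._< n) a → any (λ k → n ℕ.≤ᵇ k) a ≡ true
      large []      ¬a<n = ⊥-elim (¬a<n [])
      large (k ∷ a) ¬a<n with n ℕ.≤ᵇ k in e
      ... | true  = refl
      ... | false = large a (λ a<n → ¬a<n (ℕP.≰⇒> (λ n≤k → subst T e (ℕP.≤⇒≤ᵇ n≤k)) ∷ a<n))

    F-symmetric : IsSymmetric F
    F-symmetric a b p with all<? a
    ... | yes a<n = trans (F-small a a<n) (trans (ℤP.+-injective (trans (pairing-Σ (hActs one a) w)
      (trans (hActs-↭ (δ (w , 0)) p a<n one-reduced) (sym (pairing-Σ (hActs one b) w)))))
      (sym (F-small b (PermP.All-resp-↭ p a<n))))
    ... | no ¬a<n = trans (F-large a ¬a<n) (sym (F-large b (¬a<n ∘ PermP.All-resp-↭ (↭-sym p))))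

    F-support : ∀ a → F a ≢ 0 → All (ℕ._< n) a
    F-support a ≢0 with all<? a
    ... | yes a<n = a<n
    ... | no ¬a<n = ⊥-elim (≢0 (F-large a ¬a<n))

    F-degree : ∀ ws → All (ℕ._< n) ws → evalWord n ws ≡ w → ∀ a → F a ≢ 0 → sum a ℕ.≤ length ws
    F-degree ws ws<n e a ≢0 =
      let a<n = F-support a ≢0
          t , t∈ , t≡w = pairing-∈ (hActs one a) w (λ p → ≢0 (trans (F-small a a<n) p))
          (_ , red) , len = All.lookup (hActs-reduced a<n one-reduced) t∈
      in subst (ℕ._≤ length ws) len (shortest red ws ws<n (trans e (sym t≡w)))

    hAct-0 : ∀ v → hAct n 0 v ≡ v
    hAct-0 v = trans (ListP.++-identityʳ (uSubset n [] v)) (cong (foldl (λ v i → uAct n i v) v)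
      (ListP.filter-none (λ m → memb m [] Bool.≟ true)
        {xs = map (λ i → modℕ n (0 ℕ.+ suc i)) (upTo (suc n-2))} (All.universal (λ _ ()) _)))

    positive : List ℕ → List ℕ
    positive = filter (0 ℕ.<?_)

    hActs-positive : ∀ a v → hActs v (positive a) ≡ hActs v a
    hActs-positive []          v = refl
    hActs-positive (zero ∷ a)  v = trans (hActs-positive a v) (cong (λ v → hActs v a) (sym (hAct-0 v)))
    hActs-positive (suc k ∷ a) v = hActs-positive a (hAct n (suc k) v)

    positive-small : ∀ a → All (ℕ._< n) (positive a) → All (ℕ._< n) a
    positive-small []          a<n         = []
    positive-small (zero ∷ a)  a<n         = ℕ.s≤s ℕ.z≤n ∷ positive-small a a<n
    positive-small (suc k ∷ a) (k<n ∷ a<n) = k<n ∷ positive-small a a<n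

    F-positive : ∀ a → F (positive a) ≡ F a
    F-positive a with all<? a
    ... | yes a<n = trans (F-small (positive a) (AllP.filter⁺ (0 ℕ.<?_) a<n))
      (trans (cong (λ v → pairing v w) (hActs-positive a one)) (sym (F-small a a<n)))
    ... | no ¬a<n = trans (F-large (positive a) (¬a<n ∘ positive-small a)) (sym (F-large a ¬a<n))

    shape-↭ : ∀ a → shape a ↭ positive a
    shape-↭ a = ↭-trans (PermP.↭-reverse (S.sort (positive a))) (SortP.sort-↭ (positive a))

    F-shape : ∀ a → F (shape a) ≡ F a
    F-shape a = trans (F-symmetric (shape a) (positive a) (shape-↭ a)) (F-positive a)

-- Partitions and the finite monomial expansion

Linked-reverse : ∀ xs → Linked ℕ._≤_ xs → Linked Defs._≥_ (reverse xs)
Linked-reverse []       [] = []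
Linked-reverse (x ∷ xs) l  = go x xs [] l [-]
  where
  go : ∀ x xs acc → Linked ℕ._≤_ (x ∷ xs) → Linked Defs._≥_ (x ∷ acc) → Linked Defs._≥_ (foldl (λ ys y → y ∷ ys) (x ∷ acc) xs)
  go x []       acc [-]       d = d
  go x (y ∷ xs) acc (x≤y ∷ l) d = go y xs (x ∷ acc) l (x≤y ∷ d)

shape-partition : ∀ a → IsPartition (shape a)
shape-partition a = PermP.All-resp-↭ (↭-sym (↭-trans (PermP.↭-reverse (S.sort (filter (0 ℕ.<?_) a))) (SortP.sort-↭ (filter (0 ℕ.<?_) a)))) (AllP.all-filter (0 ℕ.<?_) a) ,
  Linked-reverse (S.sort (filter (0 ℕ.<?_) a)) (SortP.sort-↗ (filter (0 ℕ.<?_) a))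

isPartition? : ∀ λs → Dec (IsPartition λs)
isPartition? λs = All.all? (0 ℕ.<?_) λs ×-dec Linked.linked? (λ m k → k ℕ.≤? m) λs

length≤sum : ∀ λs → All (0 ℕ.<_) λs → length λs ℕ.≤ sum λs
length≤sum []       []       = ℕ.z≤n
length≤sum (k ∷ λs) (p ∷ ps) = ℕP.+-mono-≤ p (length≤sum λs ps)

sum-monomials-∉ : ∀ (f : List ℕ → ℕ) a Λ → (∀ {λs} → λs ∈ Λ → shape a ≡ λs → f λs ≡ 0) →
  sum (map (λ λs → f λs ℕ.* monomialSym λs a) Λ) ≡ 0
sum-monomials-∉ f a []       h = refl
sum-monomials-∉ f a (λs ∷ Λ) h = cong₂ ℕ._+_ head (sum-monomials-∉ f a Λ (h ∘ there))
  where
  head : f λs ℕ.* monomialSym λs a ≡ 0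
  head with ListP.≡-dec ℕ._≟_ (shape a) λs
  ... | yes e = cong (ℕ._* 1) (h (here refl) e)
  ... | no _  = ℕP.*-zeroʳ (f λs)

sum-monomials-∈ : ∀ (f : List ℕ → ℕ) a {Λ} → Unique Λ → shape a ∈ Λ →
  sum (map (λ λs → f λs ℕ.* monomialSym λs a) Λ) ≡ f (shape a)
sum-monomials-∈ f a {λs ∷ Λ} (λs∉ ∷ u) s∈ with ListP.≡-dec ℕ._≟_ (shape a) λs
... | yes refl = trans (cong₂ ℕ._+_ (ℕP.*-identityʳ (f (shape a)))
  (sum-monomials-∉ f a Λ (λ λ∈ e → ⊥-elim (All.lookup λs∉ λ∈ e)))) (ℕP.+-identityʳ _)
sum-monomials-∈ f a {λs ∷ Λ} (λs∉ ∷ u) (here e)   | no ne = ⊥-elim (ne e)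
sum-monomials-∈ f a {λs ∷ Λ} (λs∉ ∷ u) (there s∈) | no ne =
  trans (cong (ℕ._+ sum (map (λ λs → f λs ℕ.* monomialSym λs a) Λ)) (ℕP.*-zeroʳ (f λs))) (sum-monomials-∈ f a u s∈)

module Span (n-2 : ℕ) where
  open Symmetry n-2

  n : ℕ
  n = suc (suc n-2)

  module _ (w : Window n) (ws : List ℕ) (ws<n : All (ℕ._< n) ws) (ws≡w : evalWord n ws ≡ w) where

    -- A partition with non-zero coefficient has parts below `n`, and, its parts being positive,
    -- `F-degree` bounds their number by `length ws`. It is therefore literally one of the
    -- enumerated words.
    candidates : List (List ℕ)
    candidates = filter isPartition? (wordsUpTo n (length ws))

    partitions : List (List ℕ)
    partitions = deduplicate (ListP.≡-dec ℕ._≟_) candidates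

    terms : List (List ℕ × ℕ)
    terms = map (λ λs → λs , F w λs) partitions

    partition-bounds : ∀ {λs} → λs ∈ partitions → IsPartition λs × All (ℕ._≤ n ℕ.∸ 1) λs
    partition-bounds λ∈ =
      let λ∈words , part = ∈P.∈-filter⁻ isPartition? (∈P.∈-deduplicate⁻ (ListP.≡-dec ℕ._≟_) candidates λ∈)
      in part , All.map ℕP.≤-pred (proj₂ (wordsUpTo-sound n (length ws) λ∈words))

    shape∈partitions : ∀ a → F w a ≢ 0 → shape a ∈ partitions
    shape∈partitions a ≢0 = ∈P.∈-deduplicate⁺ (ListP.≡-dec ℕ._≟_) (∈P.∈-filter⁺ isPartition?
      (wordsUpTo-complete n (length ws) (shape a) (F-support w (shape a) shape≢0)
        (ℕP.≤-trans (length≤sum (shape a) (proj₁ (shape-partition a))) (F-degree w ws ws<n ws≡w (shape a) shape≢0)))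
      (shape-partition a))
      where
      shape≢0 : F w (shape a) ≢ 0
      shape≢0 e = ≢0 (trans (sym (F-shape w a)) e)

    expansion : ∀ a → F w a ≡ sum (map (λ p → proj₂ p ℕ.* monomialSym (proj₁ p) a) terms)
    expansion a = trans (by-value (F w a ℕ.≟ 0)) (cong sum (ListP.map-∘ partitions))
      where
      by-value : Dec (F w a ≡ 0) → F w a ≡ sum (map (λ λs → F w λs ℕ.* monomialSym λs a) partitions)
      by-value (yes e) = trans e (sym (sum-monomials-∉ (F w) a partitions
        λ { _ refl → trans (F-shape w a) e }))
      by-value (no ≢0) = trans (sym (F-shape w a)) (sym (sum-monomials-∈ (F w) a
        (UniqueP.deduplicate-! (ListP.≡-dec ℕ._≟_) candidates) (shape∈partitions a ≢0)))

theorem5p4 : (n : ℕ) → 3 ℕ.≤ n → (w : Window n) → InGroup n w →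
    IsSymmetricFunction (affStanleyCoeff n w) × InLambdaN n (affStanleyCoeff n w)
theorem5p4 (suc zero) (ℕ.s≤s ()) _ _
theorem5p4 (suc (suc n-2)) _ w (ws , ws<n , ws≡w) =
  (F-symmetric w , length ws , F-degree w ws ws<n ws≡w) ,
  terms w ws ws<n ws≡w ,
  AllP.map⁺ (All.tabulate (partition-bounds w ws ws<n ws≡w)) ,
  expansion w ws ws<n ws≡w
  where
  open Symmetry n-2
  open Span n-2
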